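{- Let $\mathcal{A}$ be a finite set of positive integers, let $w \leqslant z$ be real numbers, and let $m_1, m_2, m_3, m_4$ be real numbers with $(m_1, m_2) \in \mathcal{U}$ and $(m_3, m_4) \in \mathcal{U}$. Writing $M^r_4 = \sum_{1 \leqslant i_1 < \cdots < i_r \leqslant 4} m_{i_1}\cdots m_{i_r}$ and $P = m_1m_2m_3m_4$, we have $$ S(\mathcal{A}, z) \leqslant S(\mathcal{A}, w) - \frac{M^3_4 - M^2_4 + M^1_4 - 1}{P} \sum_{w \leqslant p_1 < z} S(\mathcal{A}_{p_1}, w) + \frac{2(M^2_4 - 3M^1_4 + 7)}{P} \sum_{w \leqslant p_2 < p_1 < z} S(\mathcal{A}_{p_1p_2}, w) $$ $$ - \frac{6(M^1_4 - 6)}{P} \sum_{w \leqslant p_3 < p_2 < p_1 < z} S(\mathcal{A}_{p_1p_2p_3}, w) + \frac{24}{P} \sum_{w \leqslant p_4 < p_3 < p_2 < p_1 < z} S(\mathcal{A}_{p_1p_2p_3p_4}, w). $$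
   Context: Throughout, $p, p_1, p_2, \dots$ denote prime numbers. For a finite set $\mathcal{A}$ of positive integers and a positive integer $d$, $\mathcal{A}_d = \{a : ad \in \mathcal{A}\}$. For real $z$, $S(\mathcal{A}, z)$ denotes the number of $a \in \mathcal{A}$ having no prime factor less than $z$. Let $T = (0,1] \cup [2,3] \cup [4,5] \cup \cdots$, i.e. $T$ is the union of $(0,1]$ and the intervals $[k-1,k]$ over all odd integers $k \geqslant 3$, and let $\mathcal{U} = \{(x_1, x_2) : x_1, x_2 \in T,\ |x_1 - x_2| \leqslant 1\}$. -}

module Defs where

open import Axiom.ExcludedMiddle using (ExcludedMiddle)
open import Data.Integer as ℤ using (+_; +[1+_]; +0; -[1+_])
import Data.Integer.Properties as ℤ
open import Data.List using (List; []; _∷_; _++_; map; filter; foldr; length; upTo)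
open import Data.List.Extrema.Nat using (max)
open import Data.List.Membership.DecPropositional using (_∈?_)
open import Data.List.Relation.Unary.All using (All; lookup; tabulate)
open import Data.List.Membership.Propositional.Properties using (∈-filter⁻)
open import Data.List.Relation.Unary.Unique.Propositional using (Unique)
open import Data.List.Relation.Unary.Unique.Propositional.Properties using (filter⁺; upTo⁺)
open import Data.Nat as ℕ using (ℕ; zero; suc)
open import Data.Nat.Divisibility using (_∣_; _∤_)
open import Data.Nat.Primality using (Prime)
open import Data.Nat.ListAction using (sum)
import Data.Nat.Properties as ℕ
open import Data.Product using (∃; _×_; _,_; proj₁; proj₂)
open import Data.Rational as ℚ using (ℚ; mkℚ; 0ℚ; 1ℚ; ½; positive; nonNegative)
open import Data.Rational.Literals using (fromℤ)
import Data.Rational.Properties as ℚ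
open import Data.Rational.Solver using (module +-*-Solver)
import Data.Rational.Unnormalised as ℚᵘ
import Data.Rational.Unnormalised.Properties as ℚᵘ
open import Data.Sum using (_⊎_; inj₁; inj₂)
open import Level using (0ℓ)
open import Relation.Binary.PropositionalEquality
  using (_≡_; refl; sym; trans; cong; cong₂; subst; subst₂)
open import Relation.Nullary using (¬_; yes; no; contradiction)
open import Relation.Unary using (Pred; _∈_)

private
  module Rational where
    open import Data.Rational
    open import Data.Rational.Properties
    open +-*-Solver using (solve; _:=_; _:+_; _:*_; _:-_; :-_; con)
    open ≤-Reasoning

    p≤∣p∣ : ∀ p → p ≤ ∣ p ∣
    p≤∣p∣ p with ≤-total 0ℚ p
    ... | inj₁ 0≤p = ≤-reflexive (sym (0≤p⇒∣p∣≡p 0≤p))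
    ... | inj₂ p≤0 = ≤-trans p≤0 (0≤∣p∣ p)

    -p≤∣p∣ : ∀ p → - p ≤ ∣ p ∣
    -p≤∣p∣ p = subst (- p ≤_) (∣-p∣≡∣p∣ p) (p≤∣p∣ (- p))

    ∣p∣≤ : ∀ {p d} → p ≤ d → - p ≤ d → ∣ p ∣ ≤ d
    ∣p∣≤ {p} {d} p≤d -p≤d with ∣p∣≡p∨∣p∣≡-p p
    ... | inj₁ eq = subst (_≤ d) (sym eq) p≤d
    ... | inj₂ eq = subst (_≤ d) (sym eq) -p≤d

    p-q≤r⇒p≤q+r : ∀ {p q r} → p - q ≤ r → p ≤ q + r
    p-q≤r⇒p≤q+r {p} {q} {r} h = begin
      p            ≡⟨ solve 2 (λ p q → p := q :+ (p :- q)) refl p q ⟩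
      q + (p - q)  ≤⟨ +-monoʳ-≤ q h ⟩
      q + r        ∎

    p≤q+r⇒p-q≤r : ∀ {p q r} → p ≤ q + r → p - q ≤ r
    p≤q+r⇒p-q≤r {p} {q} {r} h = begin
      p - q        ≤⟨ +-monoˡ-≤ (- q) h ⟩
      q + r - q    ≡⟨ solve 2 (λ q r → q :+ r :- q := r) refl q r ⟩
      r            ∎

    ∣p-q∣≤r⇒p≤q+r : ∀ {p q r} → ∣ p - q ∣ ≤ r → p ≤ q + r
    ∣p-q∣≤r⇒p≤q+r {p} {q} h = p-q≤r⇒p≤q+r (≤-trans (p≤∣p∣ (p - q)) h)

    ∣-∣-swap : ∀ p q → ∣ p - q ∣ ≡ ∣ q - p ∣
    ∣-∣-swap p q = trans (sym (∣-p∣≡∣p∣ (p - q)))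
      (cong ∣_∣ (solve 2 (λ p q → :- (p :- q) := q :- p) refl p q))

    ∣p∣≤∣q∣+∣p-q∣ : ∀ p q → ∣ p ∣ ≤ ∣ q ∣ + ∣ p - q ∣
    ∣p∣≤∣q∣+∣p-q∣ p q = begin
      ∣ p ∣              ≡⟨ cong ∣_∣ (solve 2 (λ p q → p := q :+ (p :- q)) refl p q) ⟩
      ∣ q + (p - q) ∣    ≤⟨ ∣p+q∣≤∣p∣+∣q∣ q (p - q) ⟩
      ∣ q ∣ + ∣ p - q ∣  ∎

    ∣∣p∣-∣q∣∣≤∣p-q∣ : ∀ p q → ∣ ∣ p ∣ - ∣ q ∣ ∣ ≤ ∣ p - q ∣
    ∣∣p∣-∣q∣∣≤∣p-q∣ p q = ∣p∣≤
      (p≤q+r⇒p-q≤r (∣p∣≤∣q∣+∣p-q∣ p q))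
      (begin
        - (∣ p ∣ - ∣ q ∣)  ≡⟨ solve 2 (λ a b → :- (a :- b) := b :- a) refl ∣ p ∣ ∣ q ∣ ⟩
        ∣ q ∣ - ∣ p ∣      ≤⟨ p≤q+r⇒p-q≤r (∣p∣≤∣q∣+∣p-q∣ q p) ⟩
        ∣ q - p ∣          ≡⟨ ∣-∣-swap q p ⟩
        ∣ p - q ∣          ∎)

    0<p*q : ∀ {p q} → 0ℚ < p → 0ℚ < q → 0ℚ < p * q
    0<p*q {p} {q} 0<p 0<q =
      positive⁻¹ (p * q) {{pos*pos⇒pos p {{positive 0<p}} q {{positive 0<q}}}}

    *-mono-≤-nonNeg : ∀ {p q r s} → 0ℚ ≤ r → 0ℚ ≤ q → p ≤ q → r ≤ s → p * r ≤ q * s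
    *-mono-≤-nonNeg {p} {q} {r} {s} 0≤r 0≤q p≤q r≤s = begin
      p * r  ≤⟨ *-monoʳ-≤-nonNeg r {{nonNegative 0≤r}} p≤q ⟩
      q * r  ≤⟨ *-monoˡ-≤-nonNeg q {{nonNegative 0≤q}} r≤s ⟩
      q * s  ∎

open Rational

-- The inverse with the convention 1/0 = 0; it is only ever applied to sequences
-- with positive limit, so only finitely many terms are affected by it.
recip : ℚ → ℚ
recip   (mkℚ +0       _ _) = 0ℚ
recip p@(mkℚ +[1+ _ ] _ _) = ℚ.1/ p
recip p@(mkℚ -[1+ _ ] _ _) = ℚ.1/ p

recip-inverse : ∀ p → 0ℚ ℚ.< p → p ℚ.* recip p ≡ 1ℚ
recip-inverse   (mkℚ +0       _ _) 0<p = contradiction (ℚ.drop-*<* 0<p) λ { (ℤ.+<+ ()) }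
recip-inverse p@(mkℚ +[1+ _ ] _ _) _   = ℚ.*-inverseʳ p
recip-inverse p@(mkℚ -[1+ _ ] _ _) _   = ℚ.*-inverseʳ p

recip-positive : ∀ p → 0ℚ ℚ.< p → 0ℚ ℚ.< recip p
recip-positive   (mkℚ +0       _ _) 0<p = contradiction (ℚ.drop-*<* 0<p) λ { (ℤ.+<+ ()) }
recip-positive p@(mkℚ +[1+ _ ] _ _) _   = ℚ.positive⁻¹ (ℚ.1/ p) {{ℚ.1/pos⇒pos p}}
recip-positive   (mkℚ -[1+ _ ] _ _) 0<p = contradiction (ℚ.drop-*<* 0<p) λ ()

IsCauchy : (ℕ → ℚ) → Set
IsCauchy s = ∀ ε → 0ℚ ℚ.< ε →
  ∃ λ N → ∀ m n → N ℕ.≤ m → N ℕ.≤ n → ℚ.∣ s m ℚ.- s n ∣ ℚ.≤ ε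

record ℝ : Set where
  constructor mkℝ
  field
    seq    : ℕ → ℚ
    cauchy : IsCauchy seq

open ℝ public

infix  4 _<_ _≤_
infixl 6 _+_ _-_
infixl 7 _*_
infix  8 -_
infix  8 _/_[_]

-- Two Cauchy sequences of rationals denote the same real number exactly when neither is less
-- than the other; no quotient is taken, and _≤_ is invariant under this relation.
_<_ : ℝ → ℝ → Set
x < y = ∃ λ ε → 0ℚ ℚ.< ε × ∃ λ N → ∀ n → N ℕ.≤ n → seq x n ℚ.+ ε ℚ.≤ seq y n

_≤_ : ℝ → ℝ → Set
x ≤ y = ¬ (y < x)

fromℚ : ℚ → ℝ
fromℚ q = mkℝ (λ _ → q) λ ε 0<ε → 0 , λ _ _ _ _ →
  subst (ℚ._≤ ε) (sym (cong ℚ.∣_∣ (ℚ.+-inverseʳ q))) (ℚ.<⇒≤ 0<ε)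

fromℕ : ℕ → ℝ
fromℕ n = fromℚ (fromℤ (+ n))

0ℝ 1ℝ : ℝ
0ℝ = fromℕ 0
1ℝ = fromℕ 1

private
  open +-*-Solver using (solve; _:=_; _:+_; _:*_; _:-_; :-_; con)
  open ℚ.≤-Reasoning

  +-cauchy : ∀ x y → IsCauchy (λ n → seq x n ℚ.+ seq y n)
  +-cauchy x y ε 0<ε = N₁ ℕ.⊔ N₂ , λ m n N≤m N≤n →
    let a = seq x m; b = seq y m; c = seq x n; d = seq y n in begin
    ℚ.∣ a ℚ.+ b ℚ.- (c ℚ.+ d) ∣
      ≡⟨ cong ℚ.∣_∣ (solve 4 (λ a b c d → a :+ b :- (c :+ d) := (a :- c) :+ (b :- d)) refl a b c d) ⟩
    ℚ.∣ (a ℚ.- c) ℚ.+ (b ℚ.- d) ∣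
      ≤⟨ ℚ.∣p+q∣≤∣p∣+∣q∣ (a ℚ.- c) (b ℚ.- d) ⟩
    ℚ.∣ a ℚ.- c ∣ ℚ.+ ℚ.∣ b ℚ.- d ∣
      ≤⟨ ℚ.+-mono-≤
           (proj₂ X m n (ℕ.m⊔n≤o⇒m≤o N₁ N₂ N≤m) (ℕ.m⊔n≤o⇒m≤o N₁ N₂ N≤n))
           (proj₂ Y m n (ℕ.m⊔n≤o⇒n≤o N₁ N₂ N≤m) (ℕ.m⊔n≤o⇒n≤o N₁ N₂ N≤n)) ⟩
    δ ℚ.+ δ
      ≡⟨ solve 1 (λ e → e :* con ½ :+ e :* con ½ := e) refl ε ⟩
    ε ∎
    where
    δ   = ε ℚ.* ½
    0<δ = 0<p*q 0<ε (ℚ.positive⁻¹ ½)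
    X   = cauchy x δ 0<δ
    Y   = cauchy y δ 0<δ
    N₁  = proj₁ X
    N₂  = proj₁ Y

  neg-cauchy : ∀ x → IsCauchy (λ n → ℚ.- seq x n)
  neg-cauchy x ε 0<ε = proj₁ X , λ m n N≤m N≤n →
    let a = seq x m; b = seq x n in begin
    ℚ.∣ ℚ.- a ℚ.- (ℚ.- b) ∣  ≡⟨ cong ℚ.∣_∣ (solve 2 (λ a b → :- a :- (:- b) := b :- a) refl a b) ⟩
    ℚ.∣ b ℚ.- a ∣            ≤⟨ proj₂ X n m N≤n N≤m ⟩
    ε                        ∎
    where X = cauchy x ε 0<ε

  abs-cauchy : ∀ x → IsCauchy (λ n → ℚ.∣ seq x n ∣)
  abs-cauchy x ε 0<ε = proj₁ X , λ m n N≤m N≤n →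
    ℚ.≤-trans (∣∣p∣-∣q∣∣≤∣p-q∣ (seq x m) (seq x n)) (proj₂ X m n N≤m N≤n)
    where X = cauchy x ε 0<ε

  eventually-bounded : ∀ x → ∃ λ B → 0ℚ ℚ.< B × ∃ λ N → ∀ n → N ℕ.≤ n → ℚ.∣ seq x n ∣ ℚ.≤ B
  eventually-bounded x = B , 0<B , N , λ n N≤n → begin
    ℚ.∣ seq x n ∣                                  ≤⟨ ∣p∣≤∣q∣+∣p-q∣ (seq x n) (seq x N) ⟩
    ℚ.∣ seq x N ∣ ℚ.+ ℚ.∣ seq x n ℚ.- seq x N ∣    ≤⟨ ℚ.+-monoʳ-≤ ℚ.∣ seq x N ∣ (proj₂ X n N N≤n ℕ.≤-refl) ⟩
    B                                              ∎
    where
    X = cauchy x 1ℚ (ℚ.positive⁻¹ 1ℚ)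
    N = proj₁ X
    B = ℚ.∣ seq x N ∣ ℚ.+ 1ℚ
    0<B : 0ℚ ℚ.< B
    0<B = ℚ.+-mono-≤-< (ℚ.0≤∣p∣ (seq x N)) (ℚ.positive⁻¹ 1ℚ)

  *-cauchy : ∀ x y → IsCauchy (λ n → seq x n ℚ.* seq y n)
  *-cauchy x y ε 0<ε = N , λ m n N≤m N≤n →
    let a = seq x m; b = seq y m; c = seq x n; d = seq y n in begin
    ℚ.∣ a ℚ.* b ℚ.- c ℚ.* d ∣
      ≡⟨ cong ℚ.∣_∣ (solve 4 (λ a b c d → a :* b :- c :* d := a :* (b :- d) :+ d :* (a :- c)) refl a b c d) ⟩
    ℚ.∣ a ℚ.* (b ℚ.- d) ℚ.+ d ℚ.* (a ℚ.- c) ∣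
      ≤⟨ ℚ.∣p+q∣≤∣p∣+∣q∣ (a ℚ.* (b ℚ.- d)) (d ℚ.* (a ℚ.- c)) ⟩
    ℚ.∣ a ℚ.* (b ℚ.- d) ∣ ℚ.+ ℚ.∣ d ℚ.* (a ℚ.- c) ∣
      ≡⟨ cong₂ ℚ._+_ (ℚ.∣p*q∣≡∣p∣*∣q∣ a (b ℚ.- d)) (ℚ.∣p*q∣≡∣p∣*∣q∣ d (a ℚ.- c)) ⟩
    ℚ.∣ a ∣ ℚ.* ℚ.∣ b ℚ.- d ∣ ℚ.+ ℚ.∣ d ∣ ℚ.* ℚ.∣ a ℚ.- c ∣
      ≤⟨ ℚ.+-mono-≤
           (*-mono-≤-nonNeg (ℚ.0≤∣p∣ (b ℚ.- d)) (ℚ.<⇒≤ 0<A)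
             (boundA m (ℕ.≤-trans N₁≤N N≤m)) (proj₂ Y m n (ℕ.≤-trans N₄≤N N≤m) (ℕ.≤-trans N₄≤N N≤n)))
           (*-mono-≤-nonNeg (ℚ.0≤∣p∣ (a ℚ.- c)) (ℚ.<⇒≤ 0<B)
             (boundB n (ℕ.≤-trans N₂≤N N≤n)) (proj₂ X m n (ℕ.≤-trans N₃≤N N≤m) (ℕ.≤-trans N₃≤N N≤n))) ⟩
    A ℚ.* δ ℚ.+ B ℚ.* δ
      ≡⟨ solve 4 (λ A B e r → A :* (e :* r) :+ B :* (e :* r) := e :* ((A :+ B) :* r)) refl A B ε (recip (A ℚ.+ B)) ⟩
    ε ℚ.* ((A ℚ.+ B) ℚ.* recip (A ℚ.+ B))
      ≡⟨ cong (ε ℚ.*_) (recip-inverse (A ℚ.+ B) 0<A+B) ⟩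
    ε ℚ.* 1ℚ
      ≡⟨ ℚ.*-identityʳ ε ⟩
    ε ∎
    where
    bx = eventually-bounded x
    by = eventually-bounded y
    A = proj₁ bx
    B = proj₁ by
    0<A = proj₁ (proj₂ bx)
    0<B = proj₁ (proj₂ by)
    boundA = proj₂ (proj₂ (proj₂ bx))
    boundB = proj₂ (proj₂ (proj₂ by))
    0<A+B : 0ℚ ℚ.< A ℚ.+ B
    0<A+B = ℚ.+-mono-< 0<A 0<B
    δ   = ε ℚ.* recip (A ℚ.+ B)
    0<δ = 0<p*q 0<ε (recip-positive (A ℚ.+ B) 0<A+B)
    X = cauchy x δ 0<δ
    Y = cauchy y δ 0<δ
    N₁ = proj₁ (proj₂ (proj₂ bx))
    N₂ = proj₁ (proj₂ (proj₂ by))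
    N₃ = proj₁ X
    N₄ = proj₁ Y
    N = (N₁ ℕ.⊔ N₂) ℕ.⊔ (N₃ ℕ.⊔ N₄)
    N₁≤N = ℕ.≤-trans (ℕ.m≤m⊔n N₁ N₂) (ℕ.m≤m⊔n (N₁ ℕ.⊔ N₂) (N₃ ℕ.⊔ N₄))
    N₂≤N = ℕ.≤-trans (ℕ.m≤n⊔m N₁ N₂) (ℕ.m≤m⊔n (N₁ ℕ.⊔ N₂) (N₃ ℕ.⊔ N₄))
    N₃≤N = ℕ.≤-trans (ℕ.m≤m⊔n N₃ N₄) (ℕ.m≤n⊔m (N₁ ℕ.⊔ N₂) (N₃ ℕ.⊔ N₄))
    N₄≤N = ℕ.≤-trans (ℕ.m≤n⊔m N₃ N₄) (ℕ.m≤n⊔m (N₁ ℕ.⊔ N₂) (N₃ ℕ.⊔ N₄))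

  -- |1/a - 1/b| = |b - a| / (ab) ≤ |b - a| / c² as soon as a, b ≥ c > 0.
  recip-cauchy : ∀ x → 0ℝ < x → IsCauchy (λ n → recip (seq x n))
  recip-cauchy x (c , 0<c , N₁ , c≤x) ε 0<ε = N , λ m n N≤m N≤n →
    let a = seq x m
        b = seq x n
        c≤a = c≤ m (ℕ.≤-trans N₁≤N N≤m)
        c≤b = c≤ n (ℕ.≤-trans N₁≤N N≤n)
        0<a = ℚ.<-≤-trans 0<c c≤a
        0<b = ℚ.<-≤-trans 0<c c≤b
        r = recip a
        s = recip b
        0<r = recip-positive a 0<a
        0<s = recip-positive b 0<b
        0≤rs = ℚ.<⇒≤ (0<p*q 0<r 0<s)
        ar≡1 = recip-inverse a 0<a
        bs≡1 = recip-inverse b 0<b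
    in begin
    ℚ.∣ r ℚ.- s ∣
      ≡⟨ cong ℚ.∣_∣ (cong₂ ℚ._-_ (sym (ℚ.*-identityˡ r)) (sym (ℚ.*-identityˡ s))) ⟩
    ℚ.∣ 1ℚ ℚ.* r ℚ.- 1ℚ ℚ.* s ∣
      ≡⟨ cong ℚ.∣_∣ (cong₂ (λ u v → u ℚ.* r ℚ.- v ℚ.* s) (sym bs≡1) (sym ar≡1)) ⟩
    ℚ.∣ (b ℚ.* s) ℚ.* r ℚ.- (a ℚ.* r) ℚ.* s ∣
      ≡⟨ cong ℚ.∣_∣ (solve 4 (λ a b r s → (b :* s) :* r :- (a :* r) :* s := (b :- a) :* (r :* s)) refl a b r s) ⟩
    ℚ.∣ (b ℚ.- a) ℚ.* (r ℚ.* s) ∣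
      ≡⟨ trans (ℚ.∣p*q∣≡∣p∣*∣q∣ (b ℚ.- a) (r ℚ.* s))
               (cong (ℚ.∣ b ℚ.- a ∣ ℚ.*_) (ℚ.0≤p⇒∣p∣≡p 0≤rs)) ⟩
    ℚ.∣ b ℚ.- a ∣ ℚ.* (r ℚ.* s)
      ≤⟨ ℚ.*-monoʳ-≤-nonNeg (r ℚ.* s) {{nonNegative 0≤rs}}
           (proj₂ X n m (ℕ.≤-trans N₂≤N N≤n) (ℕ.≤-trans N₂≤N N≤m)) ⟩
    δ ℚ.* (r ℚ.* s)
      ≤⟨ ℚ.*-monoʳ-≤-nonNeg (r ℚ.* s) {{nonNegative 0≤rs}}
           (ℚ.*-monoˡ-≤-nonNeg ε {{nonNegative (ℚ.<⇒≤ 0<ε)}}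
             (*-mono-≤-nonNeg (ℚ.<⇒≤ 0<c) (ℚ.<⇒≤ 0<a) c≤a c≤b)) ⟩
    ε ℚ.* (a ℚ.* b) ℚ.* (r ℚ.* s)
      ≡⟨ solve 5 (λ e a b r s → e :* (a :* b) :* (r :* s) := e :* ((a :* r) :* (b :* s))) refl ε a b r s ⟩
    ε ℚ.* ((a ℚ.* r) ℚ.* (b ℚ.* s))
      ≡⟨ cong (ε ℚ.*_) (cong₂ ℚ._*_ ar≡1 bs≡1) ⟩
    ε ℚ.* 1ℚ
      ≡⟨ ℚ.*-identityʳ ε ⟩
    ε ∎
    where
    c≤ : ∀ n → N₁ ℕ.≤ n → c ℚ.≤ seq x n
    c≤ n N₁≤n = subst (ℚ._≤ seq x n) (ℚ.+-identityˡ c) (c≤x n N₁≤n)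
    δ   = ε ℚ.* (c ℚ.* c)
    0<δ = 0<p*q 0<ε (0<p*q 0<c 0<c)
    X   = cauchy x δ 0<δ
    N₂  = proj₁ X
    N   = N₁ ℕ.⊔ N₂
    N₁≤N = ℕ.m≤m⊔n N₁ N₂
    N₂≤N = ℕ.m≤n⊔m N₁ N₂

_+_ : ℝ → ℝ → ℝ
x + y = mkℝ (λ n → seq x n ℚ.+ seq y n) (+-cauchy x y)

-_ : ℝ → ℝ
- x = mkℝ (λ n → ℚ.- seq x n) (neg-cauchy x)

_-_ : ℝ → ℝ → ℝ
x - y = x + (- y)

_*_ : ℝ → ℝ → ℝ
x * y = mkℝ (λ n → seq x n ℚ.* seq y n) (*-cauchy x y)

∣_∣ : ℝ → ℝ
∣ x ∣ = mkℝ (λ n → ℚ.∣ seq x n ∣) (abs-cauchy x)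

_/_[_] : ℝ → (y : ℝ) → 0ℝ < y → ℝ
x / y [ 0<y ] = x * mkℝ (λ n → recip (seq y n)) (recip-cauchy y 0<y)

*-positive : ∀ x y → 0ℝ < x → 0ℝ < y → 0ℝ < x * y
*-positive x y (c , 0<c , M , c≤x) (d , 0<d , N , d≤y) =
  c ℚ.* d , 0<p*q 0<c 0<d , M ℕ.⊔ N , λ n M⊔N≤n → begin
    0ℚ ℚ.+ c ℚ.* d
      ≡⟨ solve 2 (λ c d → con 0ℚ :+ c :* d := (con 0ℚ :+ c) :* (con 0ℚ :+ d)) refl c d ⟩
    (0ℚ ℚ.+ c) ℚ.* (0ℚ ℚ.+ d)
      ≤⟨ *-mono-≤-nonNeg (0≤0+ 0<d)
           (ℚ.≤-trans (0≤0+ 0<c) (c≤x n (ℕ.m⊔n≤o⇒m≤o M N M⊔N≤n)))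
           (c≤x n (ℕ.m⊔n≤o⇒m≤o M N M⊔N≤n))
           (d≤y n (ℕ.m⊔n≤o⇒n≤o M N M⊔N≤n)) ⟩
    seq x n ℚ.* seq y n ∎
  where
  0≤0+ : ∀ {p} → 0ℚ ℚ.< p → 0ℚ ℚ.≤ 0ℚ ℚ.+ p
  0≤0+ {p} 0<p = subst (0ℚ ℚ.≤_) (sym (ℚ.+-identityˡ p)) (ℚ.<⇒≤ 0<p)

archimedean : ∀ x → ∃ λ n → x < fromℕ n
archimedean x = suc b , 1ℚ , ℚ.positive⁻¹ 1ℚ , N , λ n N≤n → begin
  seq x n ℚ.+ 1ℚ            ≤⟨ ℚ.+-monoˡ-≤ 1ℚ (ℚ.≤-trans (p≤∣p∣ (seq x n)) (bound n N≤n)) ⟩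
  B ℚ.+ 1ℚ                  ≤⟨ ℚ.+-monoˡ-≤ 1ℚ (p≤∣↥p∣ B) ⟩
  fromℤ (+ b) ℚ.+ 1ℚ        ≡⟨ fromℤ-+1 b ⟩
  fromℤ (+ suc b)           ∎
  where
  bx = eventually-bounded x
  B = proj₁ bx
  N = proj₁ (proj₂ (proj₂ bx))
  bound = proj₂ (proj₂ (proj₂ bx))
  b = ℤ.∣ ℚ.↥ B ∣
  p≤∣↥p∣ : ∀ p → p ℚ.≤ fromℤ (+ ℤ.∣ ℚ.↥ p ∣)
  p≤∣↥p∣ (mkℚ (+ n) d _) = ℚ.*≤* (subst₂ ℤ._≤_ (ℤ.pos-* n 1) (ℤ.pos-* n (suc d))
    (ℤ.+≤+ (ℕ.*-monoʳ-≤ n (ℕ.s≤s ℕ.z≤n))))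
  p≤∣↥p∣ (mkℚ -[1+ n ] d _) = ℚ.*≤* ℤ.-≤+
  fromℤ-+1 : ∀ k → fromℤ (+ k) ℚ.+ 1ℚ ≡ fromℤ (+ suc k)
  fromℤ-+1 k = ℚ.toℚᵘ-injective
    (ℚᵘ.≃-trans (ℚ.toℚᵘ-homo-+ (fromℤ (+ k)) 1ℚ)
      (ℚᵘ.*≡* (cong (ℤ._* + 1) (trans (cong (ℤ._+ + 1) (ℤ.*-identityʳ (+ k))) (cong +_ (ℕ.+-comm k 1))))))

-- The subsequences of length r, that is, the choices of indices i₁ < ⋯ < iᵣ.
choose : {A : Set} → ℕ → List A → List (List A)
choose zero    _        = [] ∷ []
choose (suc r) []       = []
choose (suc r) (x ∷ xs) = map (x ∷_) (choose r xs) ++ choose (suc r) xs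

esym : ℕ → List ℝ → ℝ
esym r xs = foldr _+_ 0ℝ (map (foldr _*_ 1ℝ) (choose r xs))

T : Pred ℝ 0ℓ
T x = (0ℝ < x × x ≤ 1ℝ)
    ⊎ ∃ λ k → 3 ℕ.≤ k × 2 ∤ k × fromℕ k - 1ℝ ≤ x × x ≤ fromℕ k

𝓤 : Pred (ℝ × ℝ) 0ℓ
𝓤 (x₁ , x₂) = x₁ ∈ T × x₂ ∈ T × ∣ x₁ - x₂ ∣ ≤ 1ℝ

T⇒positive : ∀ x → x ∈ T → 0ℝ < x
T⇒positive x (inj₁ (0<x , _)) = 0<x
T⇒positive x (inj₂ (k , 3≤k , _ , k-1≤x , _)) with 1ℚ ℚ.≤? seq x (proj₁ (cauchy x ½ (ℚ.positive⁻¹ ½)))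
... | yes 1≤q = ½ , ℚ.positive⁻¹ ½ , N , λ n N≤n → begin
    0ℚ ℚ.+ ½            ≡⟨⟩
    1ℚ ℚ.- ½            ≤⟨ ℚ.+-monoˡ-≤ (ℚ.- ½) 1≤q ⟩
    seq x N ℚ.- ½       ≤⟨ ℚ.+-monoˡ-≤ (ℚ.- ½) (∣p-q∣≤r⇒p≤q+r {seq x N} {seq x n} (proj₂ X N n ℕ.≤-refl N≤n)) ⟩
    seq x n ℚ.+ ½ ℚ.- ½ ≡⟨ solve 1 (λ p → p :+ con ½ :- con ½ := p) refl (seq x n) ⟩
    seq x n             ∎
  where
  X = cauchy x ½ (ℚ.positive⁻¹ ½)
  N = proj₁ X
... | no 1≰q = contradiction
    (½ , ℚ.positive⁻¹ ½ , N , λ n N≤n → begin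
      seq x n ℚ.+ ½           ≤⟨ ℚ.+-monoˡ-≤ ½ (∣p-q∣≤r⇒p≤q+r {seq x n} {seq x N} (proj₂ X n N N≤n ℕ.≤-refl)) ⟩
      seq x N ℚ.+ ½ ℚ.+ ½     ≤⟨ ℚ.+-monoˡ-≤ ½ (ℚ.+-monoˡ-≤ ½ (ℚ.<⇒≤ (ℚ.≰⇒> 1≰q))) ⟩
      1ℚ ℚ.+ ½ ℚ.+ ½          ≡⟨⟩
      fromℤ (+ 3) ℚ.- 1ℚ      ≤⟨ ℚ.+-monoˡ-≤ (ℚ.- 1ℚ) 3≤k′ ⟩
      fromℤ (+ k) ℚ.- 1ℚ      ∎)
    k-1≤x
  where
  X = cauchy x ½ (ℚ.positive⁻¹ ½)
  N = proj₁ X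
  3≤k′ : fromℤ (+ 3) ℚ.≤ fromℤ (+ k)
  3≤k′ = ℚ.*≤* (subst₂ ℤ._≤_ (ℤ.pos-* 3 1) (ℤ.pos-* k 1) (ℤ.+≤+ (ℕ.*-monoˡ-≤ 1 3≤k)))

𝓤⇒product-positive : ∀ m₁ m₂ m₃ m₄ → (m₁ , m₂) ∈ 𝓤 → (m₃ , m₄) ∈ 𝓤 →
                     0ℝ < m₁ * m₂ * m₃ * m₄
𝓤⇒product-positive m₁ m₂ m₃ m₄ (t₁ , t₂ , _) (t₃ , t₄ , _) =
  *-positive (m₁ * m₂ * m₃) m₄
    (*-positive (m₁ * m₂) m₃
      (*-positive m₁ m₂ (T⇒positive m₁ t₁) (T⇒positive m₂ t₂))
      (T⇒positive m₃ t₃))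
    (T⇒positive m₄ t₄)

record FiniteSet⁺ : Set where
  field
    elements : List ℕ
    unique   : Unique elements
    nonZero  : All (0 ℕ.<_) elements

open FiniteSet⁺ public

-- 𝒜 ⟨ d ⟩ = { a : a d ∈ 𝒜 }.  The search range loses nothing: 0 ∉ 𝒜, so a d ∈ 𝒜
-- forces d ≥ 1 and hence a ≤ a d ≤ max 𝒜.
_⟨_⟩ : FiniteSet⁺ → ℕ → FiniteSet⁺
𝒜 ⟨ d ⟩ = record
  { elements = filter ad∈? range
  ; unique   = filter⁺ ad∈? (upTo⁺ (suc (max 0 (elements 𝒜))))
  ; nonZero  = tabulate λ a∈ →
      positive-factor (lookup (nonZero 𝒜) (proj₂ (∈-filter⁻ ad∈? {xs = range} a∈)))
  }
  where
  range = upTo (suc (max 0 (elements 𝒜)))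
  ad∈? = λ a → _∈?_ ℕ._≟_ (a ℕ.* d) (elements 𝒜)
  positive-factor : ∀ {a} → 0 ℕ.< a ℕ.* d → 0 ℕ.< a
  positive-factor {suc a} _ = ℕ.s≤s ℕ.z≤n

∑ : List ℕ → (ℕ → ℕ) → ℕ
∑ ps f = sum (map f ps)

infix 5 ∑-syntax
∑-syntax : List ℕ → (ℕ → ℕ) → ℕ
∑-syntax = ∑
syntax ∑-syntax ps (λ p → e) = ∑[ p ∈ ps ] e

HasPrimeFactorBelow : ℝ → ℕ → Set
HasPrimeFactorBelow z a = ∃ λ p → Prime p × p ∣ a × fromℕ p < z

-- Comparing an integer with a real number is not decidable constructively, so the
-- counting function and the prime ranges are formed classically.
module Sieve (em : ExcludedMiddle 0ℓ) where

  S : FiniteSet⁺ → ℝ → ℕ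
  S 𝒜 z = length (filter (λ a → em {¬ HasPrimeFactorBelow z a}) (elements 𝒜))

  -- The primes p with w ≤ p < z; the bound is a natural number exceeding z.
  primes[_,_⟩ : ℝ → ℝ → List ℕ
  primes[ w , z ⟩ =
    filter (λ p → em {Prime p × w ≤ fromℕ p × fromℕ p < z}) (upTo (proj₁ (archimedean z)))

module Submission where

-- For a ∈ 𝒜 free of prime factors below w, let c be the number of primes in [w, z) dividing a.
-- Then a contributes C(c, r) to the r-fold sum on the right, so in total
-- (m₁ - c)(m₂ - c)(m₃ - c)(m₄ - c) / P, which is 1 if c = 0.  It is never negative: T has a gap
-- (j, j + 1) for every odd j, so for (x, y) ∈ 𝓤 no positive integer lies strictly between x and y.

open import Axiom.ExcludedMiddle using (ExcludedMiddle)
open import Data.Integer as ℤ using (+_)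
import Data.Integer.Properties as ℤ
open import Data.List using (List; []; _∷_; _++_; foldr; map; filter; length; upTo)
open import Data.List.Extrema.Nat using (xs≤max)
open import Data.List.Membership.DecPropositional using (_∈?_)
open import Data.List.Membership.Propositional using () renaming (_∈_ to _∈ˡ_)
open import Data.List.Membership.Propositional.Properties
  using (∈-filter⁺; ∈-filter⁻; ∈-map⁺; ∈-map⁻; ∈-upTo⁺; ∈-upTo⁻)
open import Data.List.Membership.Propositional.Properties.WithK using (unique∧set⇒bag)
open import Data.List.Properties using (length-map; length-++; filter-++; upTo-∷ʳ)
open import Data.List.Relation.Binary.BagAndSetEquality using (∼bag⇒↭)
open import Data.List.Relation.Binary.Permutation.Propositional using (_↭_)
open import Data.List.Relation.Binary.Permutation.Propositional.Properties
  using (↭-length) renaming (map⁺ to ↭-map⁺)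
import Data.List.Relation.Unary.All as All
open import Data.List.Relation.Unary.Any using (here; there)
import Data.List.Relation.Unary.Unique.Propositional.Properties as Unique
open import Data.Nat as ℕ using (ℕ; zero; suc; z≤n; s≤s)
open import Data.Nat.Combinatorics using (_C_; nCk+nC[k+1]≡[n+1]C[k+1]; nC1≡n)
open import Data.Nat.Divisibility
  using (_∣_; _∤_; _∣?_; divides; ∣-trans; 1∣_; ∣1⇒≡1; ∣m⇒∣m*n; m∣m*n; n∣m*n; *-monoˡ-∣; ∣m+n∣m⇒∣n)
open import Data.Nat.ListAction.Properties using (sum-↭)
open import Data.Nat.Primality
  using (Prime; euclidsLemma; prime⇒nonZero; prime⇒irreducible; ¬prime[1])
import Data.Nat.Properties as ℕ
import Data.Nat.Solver as ℕ
open import Data.Product using (∃; _×_; _,_; proj₁; proj₂; swap)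
open import Data.Rational as ℚ using (ℚ; 0ℚ; 1ℚ; ½)
open import Data.Rational.Literals using (fromℤ)
import Data.Rational.Properties as ℚ
open import Data.Rational.Solver using (module +-*-Solver)
import Data.Rational.Unnormalised as ℚᵘ
import Data.Rational.Unnormalised.Properties as ℚᵘ
open import Data.Sum as Sum using (_⊎_; inj₁; inj₂)
open import Function using (_∘_; _⇔_; mk⇔; Equivalence)
open import Level using (0ℓ)
open import Relation.Binary.PropositionalEquality
open import Relation.Nullary using (¬_; Dec; yes; no; contradiction; _×-dec_)
open import Relation.Unary using (_∈_; Pred; Decidable)
open import Defs

-- A real is a Cauchy sequence of rationals, so identities are proved by the ring solver between
-- n-th terms, and only signs concern the limit. `NonNegative` allows every late term to fall short
-- by any ε > 0; it survives sums, products and changes of finitely many terms. The last point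
-- matters because `recip` is known to invert the terms of P only once they are positive. Excluded
-- middle serves the sieve side alone. For the signs, membership in `T` supplies the number of an
-- interval, so the side of a gap on which a point lies is decided by comparing natural numbers. The
-- r-fold sum gives C(c, r) because its primes decrease: each set of r of the c primes is chosen
-- once, and divisibility by the product splits into divisibility by each of these distinct primes.

-- Finite sums over lists and indicators

∑-cong : ∀ xs {f g : ℕ → ℕ} → (∀ {x} → x ∈ˡ xs → f x ≡ g x) → ∑ xs f ≡ ∑ xs g
∑-cong []       eq = refl
∑-cong (x ∷ xs) eq = cong₂ ℕ._+_ (eq (here refl)) (∑-cong xs (eq ∘ there))

∑-zero : ∀ xs → ∑ xs (λ _ → 0) ≡ 0
∑-zero []       = refl
∑-zero (x ∷ xs) = ∑-zero xs

∑-+ : ∀ xs (f g : ℕ → ℕ) → ∑ xs (λ x → f x ℕ.+ g x) ≡ ∑ xs f ℕ.+ ∑ xs g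
∑-+ []       f g = refl
∑-+ (x ∷ xs) f g = trans (cong (f x ℕ.+ g x ℕ.+_) (∑-+ xs f g))
  (solve 4 (λ a b c d → a :+ b :+ (c :+ d) := a :+ c :+ (b :+ d)) refl (f x) (g x) (∑ xs f) (∑ xs g))
  where open ℕ.+-*-Solver

∑-distribˡ : ∀ c xs (f : ℕ → ℕ) → c ℕ.* ∑ xs f ≡ ∑ xs (λ x → c ℕ.* f x)
∑-distribˡ c []       f = ℕ.*-zeroʳ c
∑-distribˡ c (x ∷ xs) f =
  trans (ℕ.*-distribˡ-+ c (f x) (∑ xs f)) (cong (c ℕ.* f x ℕ.+_) (∑-distribˡ c xs f))

∑-swap : ∀ xs ys (f : ℕ → ℕ → ℕ) → ∑ xs (λ x → ∑ ys (f x)) ≡ ∑ ys (λ y → ∑ xs (λ x → f x y))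
∑-swap []       ys f = sym (∑-zero ys)
∑-swap (x ∷ xs) ys f = trans (cong (∑ ys (f x) ℕ.+_) (∑-swap xs ys f))
  (sym (∑-+ ys (f x) (λ y → ∑ xs (λ x → f x y))))

∑-++ : ∀ xs ys (f : ℕ → ℕ) → ∑ (xs ++ ys) f ≡ ∑ xs f ℕ.+ ∑ ys f
∑-++ []       ys f = refl
∑-++ (x ∷ xs) ys f = trans (cong (f x ℕ.+_) (∑-++ xs ys f)) (sym (ℕ.+-assoc (f x) _ _))

∑-↭ : ∀ {xs ys} (f : ℕ → ℕ) → xs ↭ ys → ∑ xs f ≡ ∑ ys f
∑-↭ f = sum-↭ ∘ ↭-map⁺ f

𝟙 : {P : Set} → Dec P → ℕ
𝟙 (yes _) = 1
𝟙 (no  _) = 0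

𝟙-cong : {P Q : Set} (p? : Dec P) (q? : Dec Q) → (P → Q) → (Q → P) → 𝟙 p? ≡ 𝟙 q?
𝟙-cong (yes p) (yes q) f g = refl
𝟙-cong (yes p) (no ¬q) f g = contradiction (f p) ¬q
𝟙-cong (no ¬p) (yes q) f g = contradiction (g q) ¬p
𝟙-cong (no ¬p) (no ¬q) f g = refl

𝟙-× : {P Q : Set} (p? : Dec P) (q? : Dec Q) → 𝟙 (p? ×-dec q?) ≡ 𝟙 p? ℕ.* 𝟙 q?
𝟙-× (yes p) (yes q) = refl
𝟙-× (yes p) (no ¬q) = refl
𝟙-× (no ¬p) _       = refl

-- Counting in initial segments of ℕ

module _ {P : Pred ℕ 0ℓ} (P? : Decidable P) where

  ∑-filter : ∀ xs (f : ℕ → ℕ) → ∑ (filter P? xs) f ≡ ∑ xs (λ x → 𝟙 (P? x) ℕ.* f x)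
  ∑-filter []       f = refl
  ∑-filter (x ∷ xs) f with P? x
  ... | yes _ = cong₂ ℕ._+_ (sym (ℕ.*-identityˡ (f x))) (∑-filter xs f)
  ... | no  _ = ∑-filter xs f

  length-filter-∑ : ∀ xs → length (filter P? xs) ≡ ∑ xs (𝟙 ∘ P?)
  length-filter-∑ []       = refl
  length-filter-∑ (x ∷ xs) with P? x
  ... | yes _ = cong suc (length-filter-∑ xs)
  ... | no  _ = length-filter-∑ xs

  count : ℕ → ℕ
  count n = length (filter P? (upTo n))

  filter-upTo-suc : ∀ n → filter P? (upTo (suc n)) ≡ filter P? (upTo n) ++ filter P? (n ∷ [])
  filter-upTo-suc n = trans (cong (filter P?) (sym (upTo-∷ʳ n))) (filter-++ P? (upTo n) (n ∷ []))

  -- Hockey-stick identity: count runs through 0, 1, 2, … along the filtered list.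
  ∑-count-C : ∀ n r → ∑ (filter P? (upTo n)) (λ p → count p C r) ≡ count n C suc r
  ∑-count-C zero    r = refl
  ∑-count-C (suc n) r = begin
    ∑ (filter P? (upTo (suc n))) f
      ≡⟨ cong (λ xs → ∑ xs f) (filter-upTo-suc n) ⟩
    ∑ (filter P? (upTo n) ++ filter P? (n ∷ [])) f
      ≡⟨ ∑-++ (filter P? (upTo n)) (filter P? (n ∷ [])) f ⟩
    ∑ (filter P? (upTo n)) f ℕ.+ ∑ (filter P? (n ∷ [])) f
      ≡⟨ cong (ℕ._+ ∑ (filter P? (n ∷ [])) f) (∑-count-C n r) ⟩
    count n C suc r ℕ.+ ∑ (filter P? (n ∷ [])) f
      ≡⟨ last ⟩
    (count n ℕ.+ length (filter P? (n ∷ []))) C suc r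
      ≡⟨ cong (_C suc r) (sym (trans (cong length (filter-upTo-suc n)) (length-++ (filter P? (upTo n))))) ⟩
    count (suc n) C suc r ∎
    where
    open ≡-Reasoning
    f = λ p → count p C r
    last : count n C suc r ℕ.+ ∑ (filter P? (n ∷ [])) f ≡ (count n ℕ.+ length (filter P? (n ∷ []))) C suc r
    last with P? n
    ... | no  _ = trans (ℕ.+-identityʳ _) (cong (_C suc r) (sym (ℕ.+-identityʳ (count n))))
    ... | yes _ = begin
      count n C suc r ℕ.+ (count n C r ℕ.+ 0)  ≡⟨ cong (count n C suc r ℕ.+_) (ℕ.+-identityʳ _) ⟩
      count n C suc r ℕ.+ count n C r          ≡⟨ ℕ.+-comm (count n C suc r) (count n C r) ⟩
      count n C r ℕ.+ count n C suc r          ≡⟨ nCk+nC[k+1]≡[n+1]C[k+1] (count n) r ⟩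
      suc (count n) C suc r                    ≡⟨ cong (_C suc r) (ℕ.+-comm 1 (count n)) ⟩
      (count n ℕ.+ 1) C suc r                  ∎

-- Natural numbers inside ℚ and ceilings of reals

cast : ℕ → ℚ
cast n = fromℤ (+ n)

cast-+ : ∀ m n → cast (m ℕ.+ n) ≡ cast m ℚ.+ cast n
cast-+ m n = ℚ.toℚᵘ-injective (ℚᵘ.≃-sym (ℚᵘ.≃-trans (ℚ.toℚᵘ-homo-+ (cast m) (cast n))
  (ℚᵘ.*≡* (cong (ℤ._* + 1) (cong₂ ℤ._+_ (ℤ.*-identityʳ (+ m)) (ℤ.*-identityʳ (+ n)))))))

cast-* : ∀ m n → cast (m ℕ.* n) ≡ cast m ℚ.* cast n
cast-* m n = ℚ.toℚᵘ-injective (ℚᵘ.≃-sym (ℚᵘ.≃-trans (ℚ.toℚᵘ-homo-* (cast m) (cast n))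
  (ℚᵘ.*≡* (cong (ℤ._* + 1) (sym (ℤ.pos-* m n))))))

cast-mono-≤ : ∀ {m n} → m ℕ.≤ n → cast m ℚ.≤ cast n
cast-mono-≤ m≤n = ℚ.*≤* (ℤ.*-monoʳ-≤-nonNeg (+ 1) (ℤ.+≤+ m≤n))

cast-cancel-< : ∀ {m n} → cast m ℚ.< cast n → m ℕ.< n
cast-cancel-< {m} {n} m<n with n ℕ.≤? m
... | yes n≤m = contradiction (ℚ.<-≤-trans m<n (cast-mono-≤ n≤m)) (ℚ.<-irrefl refl)
... | no  n≰m = ℕ.≰⇒> n≰m

p<p+q : ∀ p {q} → 0ℚ ℚ.< q → p ℚ.< p ℚ.+ q
p<p+q p {q} 0<q = subst (ℚ._< p ℚ.+ q) (ℚ.+-identityʳ p) (ℚ.+-monoʳ-< p 0<q)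

<-trans : ∀ {x y z} → x < y → y < z → x < z
<-trans {x} {y} {z} (δ , 0<δ , M , x<y) (ε , 0<ε , N , y<z) = δ , 0<δ , M ℕ.⊔ N , λ n M⊔N≤n → begin
  seq x n ℚ.+ δ  ≤⟨ x<y n (ℕ.m⊔n≤o⇒m≤o M N M⊔N≤n) ⟩
  seq y n        ≤⟨ ℚ.<⇒≤ (p<p+q (seq y n) 0<ε) ⟩
  seq y n ℚ.+ ε  ≤⟨ y<z n (ℕ.m⊔n≤o⇒n≤o M N M⊔N≤n) ⟩
  seq z n        ∎
  where open ℚ.≤-Reasoning

-- Only the cut that `x` makes in ℕ matters for a prime range, so the ceiling is encoded by that
-- cut; it is 0 whenever `x` ≤ 0. Ranges p < x thus become initial segments, on which induction is
-- possible.
IsCeiling : ℝ → ℕ → Set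
IsCeiling x n = ∀ p → fromℕ p < x ⇔ p ℕ.< n

fromℕ-ceiling : ∀ n → IsCeiling (fromℕ n) n
fromℕ-ceiling n p = mk⇔
  (λ (ε , 0<ε , N , p+ε≤n) → cast-cancel-< (ℚ.<-≤-trans (p<p+q (cast p) 0<ε) (p+ε≤n N ℕ.≤-refl)))
  (λ p<n → 1ℚ , ℚ.positive⁻¹ 1ℚ , 0 , λ _ _ →
    ℚ.≤-trans (ℚ.≤-reflexive (sym (cast-+ p 1))) (cast-mono-≤ (subst (ℕ._≤ n) (ℕ.+-comm 1 p) p<n)))

-- The archimedean bound is lowered as long as its predecessor is not below `x`; excluded middle
-- decides each of these comparisons.
ceiling : ExcludedMiddle 0ℓ → ∀ x → ∃ (IsCeiling x)
ceiling em x = search (proj₁ (archimedean x)) λ p p<x → to (fromℕ-ceiling _ p)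
  (<-trans {fromℕ p} {x} {fromℕ (proj₁ (archimedean x))} p<x (proj₂ (archimedean x)))
  where
  open Equivalence
  search : ∀ b → (∀ p → fromℕ p < x → p ℕ.< b) → ∃ (IsCeiling x)
  search zero    <b = 0 , λ p → mk⇔ (<b p) λ ()
  search (suc b) <b with em {fromℕ b < x}
  ... | no  b≮x = search b λ p p<x → ℕ.≤∧≢⇒< (ℕ.s≤s⁻¹ (<b p p<x)) λ { refl → b≮x p<x }
  ... | yes b<x = suc b , λ p → mk⇔ (<b p) (λ { (s≤s p≤b) → below (ℕ.m≤n⇒m<n∨m≡n p≤b) })
    where
    below : ∀ {p} → p ℕ.< b ⊎ p ≡ b → fromℕ p < x
    below {p} (inj₁ p<b)  = <-trans {fromℕ p} {fromℕ b} {x} (from (fromℕ-ceiling b p) p<b) b<x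
    below     (inj₂ refl) = b<x

-- Iterated prime sums as sums of binomial coefficients

module _ (em : ExcludedMiddle 0ℓ) (w : ℝ) where

  open Sieve em
  open Equivalence

  Rough : ℕ → Set
  Rough a = ¬ HasPrimeFactorBelow w a

  rough? : Decidable Rough
  rough? a = em

  SievePrime : ℕ → Set
  SievePrime p = Prime p × w ≤ fromℕ p

  sievePrime? : Decidable SievePrime
  sievePrime? p = em

  sievePrimes : ℕ → List ℕ
  sievePrimes n = filter sievePrime? (upTo n)

  -- The two lists filter different initial segments by different predicates. Neither has
  -- repetitions, so equal membership already makes them permutations of each other, which is enough
  -- for sums.
  primes-↭ : ∀ {x n} → IsCeiling x n → primes[ w , x ⟩ ↭ sievePrimes n
  primes-↭ {x} {n} ceil = ∼bag⇒↭ (unique∧set⇒bag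
    (Unique.filter⁺ inRange? (Unique.upTo⁺ bound)) (Unique.filter⁺ sievePrime? (Unique.upTo⁺ n)) λ {p} → mk⇔
    (λ p∈ → let _ , pr , w≤p , p<x = ∈-filter⁻ inRange? {xs = upTo bound} p∈
            in ∈-filter⁺ sievePrime? (∈-upTo⁺ (to (ceil p) p<x)) (pr , w≤p))
    (λ p∈ → let p∈n , pr , w≤p = ∈-filter⁻ sievePrime? {xs = upTo n} p∈
                p<x = from (ceil p) (∈-upTo⁻ p∈n)
            in ∈-filter⁺ inRange? (∈-upTo⁺ (p<bound p p<x)) (pr , w≤p , p<x)))
    where
    bound = proj₁ (archimedean x)
    inRange? = λ p → em {Prime p × w ≤ fromℕ p × fromℕ p < x}
    p<bound : ∀ p → fromℕ p < x → p ℕ.< bound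
    p<bound p p<x = to (fromℕ-ceiling bound p) (<-trans {fromℕ p} {x} {fromℕ bound} p<x (proj₂ (archimedean x)))

  -- Multiplication by `d` is a bijection from the rough elements of `𝒜 ⟨ d ⟩` to the rough
  -- multiples of `d` in `𝒜`: since `d` has no prime factor below `w`, it cannot spoil roughness.
  S⟨⟩-∑ : ∀ 𝒜 d .{{_ : ℕ.NonZero d}} → (∀ {q} → Prime q → q ∣ d → w ≤ fromℕ q) →
         S (𝒜 ⟨ d ⟩) w ≡ ∑[ a ∈ elements 𝒜 ] 𝟙 (rough? a) ℕ.* 𝟙 (d ∣? a)
  S⟨⟩-∑ 𝒜 d w≤ = begin
    length (filter rough? (elements (𝒜 ⟨ d ⟩)))
      ≡⟨ sym (length-map (ℕ._* d) (filter rough? (elements (𝒜 ⟨ d ⟩)))) ⟩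
    length (map (ℕ._* d) (filter rough? (elements (𝒜 ⟨ d ⟩))))
      ≡⟨ ↭-length multiples ⟩
    length (filter (λ a → rough? a ×-dec d ∣? a) (elements 𝒜))
      ≡⟨ length-filter-∑ (λ a → rough? a ×-dec d ∣? a) (elements 𝒜) ⟩
    ∑[ a ∈ elements 𝒜 ] 𝟙 (rough? a ×-dec d ∣? a)
      ≡⟨ ∑-cong (elements 𝒜) (λ {a} _ → 𝟙-× (rough? a) (d ∣? a)) ⟩
    ∑[ a ∈ elements 𝒜 ] 𝟙 (rough? a) ℕ.* 𝟙 (d ∣? a) ∎
    where
    open ≡-Reasoning
    range = upTo (suc _)
    bd∈? = λ b → _∈?_ ℕ._≟_ (b ℕ.* d) (elements 𝒜)
    rough∣? = λ a → rough? a ×-dec d ∣? a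
    rough-* : ∀ {b} → Rough b → Rough (b ℕ.* d)
    rough-* {b} rough (q , prime-q , q∣bd , q<w) with euclidsLemma b d prime-q q∣bd
    ... | inj₁ q∣b = rough (q , prime-q , q∣b , q<w)
    ... | inj₂ q∣d = w≤ prime-q q∣d q<w
    multiples : map (ℕ._* d) (filter rough? (elements (𝒜 ⟨ d ⟩))) ↭ filter rough∣? (elements 𝒜)
    multiples = ∼bag⇒↭ (unique∧set⇒bag
      (Unique.map⁺ (λ {x} {y} → ℕ.*-cancelʳ-≡ x y d) (Unique.filter⁺ rough? (unique (𝒜 ⟨ d ⟩))))
      (Unique.filter⁺ rough∣? (unique 𝒜)) (mk⇔ fwd bwd))
      where
      fwd : ∀ {a} → a ∈ˡ map (ℕ._* d) (filter rough? (elements (𝒜 ⟨ d ⟩))) → a ∈ˡ filter rough∣? (elements 𝒜)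
      fwd a∈ with b , b∈ , refl ← ∈-map⁻ (ℕ._* d) a∈
             with b∈⟨d⟩ , rough ← ∈-filter⁻ rough? {xs = elements (𝒜 ⟨ d ⟩)} b∈ =
        ∈-filter⁺ rough∣? (proj₂ (∈-filter⁻ bd∈? {xs = range} b∈⟨d⟩)) (rough-* rough , n∣m*n b)
      bwd : ∀ {a} → a ∈ˡ filter rough∣? (elements 𝒜) → a ∈ˡ map (ℕ._* d) (filter rough? (elements (𝒜 ⟨ d ⟩)))
      bwd a∈ with bd∈ , rough , divides b refl ← ∈-filter⁻ rough∣? {xs = elements 𝒜} a∈ =
        ∈-map⁺ (ℕ._* d) (∈-filter⁺ rough?
          (∈-filter⁺ bd∈? (∈-upTo⁺ (s≤s (ℕ.≤-trans (ℕ.m≤m*n b d) (All.lookup (xs≤max 0 (elements 𝒜)) bd∈)))) bd∈)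
          (λ { (q , prime-q , q∣b , q<w) → rough (q , prime-q , ∣m⇒∣m*n d q∣b , q<w) }))

  divides? : ∀ a → Decidable (λ p → SievePrime p × p ∣ a)
  divides? a p = sievePrime? p ×-dec p ∣? a

  -- `d` is the product of the primes chosen so far and `x` bounds the next one from above.
  -- Multiplying on the right reproduces the left-nested products of the theorem.
  iterated : FiniteSet⁺ → ℕ → ℝ → ℕ → ℕ
  iterated 𝒜 zero    x d = S (𝒜 ⟨ d ⟩) w
  iterated 𝒜 (suc r) x d = ∑[ p ∈ primes[ w , x ⟩ ] iterated 𝒜 r (fromℕ p) (d ℕ.* p)

  -- Induction on `r` needs a general `d`. As the prime factors of `d` are at least `n`, the next
  -- prime p < n does not divide `d`, so that d p ∣ a splits into d ∣ a and p ∣ a. After exchanging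
  -- the sums, the primes dividing a fixed a are summed by `∑-count-C`.
  iterated-∑ : ∀ 𝒜 r {x n} d → IsCeiling x n → .{{_ : ℕ.NonZero d}} →
               (∀ {q} → Prime q → q ∣ d → w ≤ fromℕ q × n ℕ.≤ q) →
               iterated 𝒜 r x d ≡
               ∑[ a ∈ elements 𝒜 ] 𝟙 (rough? a) ℕ.* 𝟙 (d ∣? a) ℕ.* (count (divides? a) n C r)
  iterated-∑ 𝒜 zero    d ceil factors = trans (S⟨⟩-∑ 𝒜 d (λ pr → proj₁ ∘ factors pr))
    (∑-cong (elements 𝒜) λ _ → sym (ℕ.*-identityʳ _))
  iterated-∑ 𝒜 (suc r) {x} {n} d ceil factors = begin
    ∑[ p ∈ primes[ w , x ⟩ ] iterated 𝒜 r (fromℕ p) (d ℕ.* p)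
      ≡⟨ ∑-↭ (λ p → iterated 𝒜 r (fromℕ p) (d ℕ.* p)) (primes-↭ {x} {n} ceil) ⟩
    ∑[ p ∈ sievePrimes n ] iterated 𝒜 r (fromℕ p) (d ℕ.* p)
      ≡⟨ ∑-cong (sievePrimes n) step ⟩
    ∑[ p ∈ sievePrimes n ] ∑[ a ∈ elements 𝒜 ] u a ℕ.* (𝟙 (p ∣? a) ℕ.* (c a p C r))
      ≡⟨ ∑-swap (sievePrimes n) (elements 𝒜) _ ⟩
    ∑[ a ∈ elements 𝒜 ] ∑[ p ∈ sievePrimes n ] u a ℕ.* (𝟙 (p ∣? a) ℕ.* (c a p C r))
      ≡⟨ ∑-cong (elements 𝒜) (λ {a} _ → trans (sym (∑-distribˡ (u a) (sievePrimes n) _)) (cong (u a ℕ.*_) (inner a))) ⟩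
    ∑[ a ∈ elements 𝒜 ] u a ℕ.* (c a n C suc r) ∎
    where
    open ≡-Reasoning
    u = λ a → 𝟙 (rough? a) ℕ.* 𝟙 (d ∣? a)
    c = λ a → count (divides? a)

    inner : ∀ a → ∑[ p ∈ sievePrimes n ] 𝟙 (p ∣? a) ℕ.* (c a p C r) ≡ c a n C suc r
    inner a = begin
      ∑[ p ∈ sievePrimes n ] 𝟙 (p ∣? a) ℕ.* (c a p C r)
        ≡⟨ ∑-filter sievePrime? (upTo n) _ ⟩
      ∑[ p ∈ upTo n ] 𝟙 (sievePrime? p) ℕ.* (𝟙 (p ∣? a) ℕ.* (c a p C r))
        ≡⟨ ∑-cong (upTo n) (λ {p} _ → trans (sym (ℕ.*-assoc (𝟙 (sievePrime? p)) _ _))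
             (cong (ℕ._* (c a p C r)) (sym (𝟙-× (sievePrime? p) (p ∣? a))))) ⟩
      ∑[ p ∈ upTo n ] 𝟙 (divides? a p) ℕ.* (c a p C r)
        ≡⟨ sym (∑-filter (divides? a) (upTo n) _) ⟩
      ∑[ p ∈ filter (divides? a) (upTo n) ] (c a p C r)
        ≡⟨ ∑-count-C (divides? a) n r ⟩
      c a n C suc r ∎

    step : ∀ {p} → p ∈ˡ sievePrimes n → iterated 𝒜 r (fromℕ p) (d ℕ.* p) ≡
           ∑[ a ∈ elements 𝒜 ] u a ℕ.* (𝟙 (p ∣? a) ℕ.* (c a p C r))
    step {p} p∈ with p∈n , prime-p , w≤p ← ∈-filter⁻ sievePrime? {xs = upTo n} p∈ = trans
      -- The remaining primes lie below `p`, which is its own ceiling; hence the count below `p`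
      -- that the hockey-stick identity sums.
      (iterated-∑ 𝒜 r {fromℕ p} (d ℕ.* p) (fromℕ-ceiling p) {{ℕ.m*n≢0 d p}} factors′)
      (∑-cong (elements 𝒜) λ {a} _ → begin
        𝟙 (rough? a) ℕ.* 𝟙 (d ℕ.* p ∣? a) ℕ.* (c a p C r)
          ≡⟨ cong (λ t → 𝟙 (rough? a) ℕ.* t ℕ.* (c a p C r)) (𝟙-∣ a) ⟩
        𝟙 (rough? a) ℕ.* (𝟙 (d ∣? a) ℕ.* 𝟙 (p ∣? a)) ℕ.* (c a p C r)
          ≡⟨ solve 4 (λ t u v x → t :* (u :* v) :* x := t :* u :* (v :* x)) refl
               (𝟙 (rough? a)) (𝟙 (d ∣? a)) (𝟙 (p ∣? a)) (c a p C r) ⟩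
        u a ℕ.* (𝟙 (p ∣? a) ℕ.* (c a p C r)) ∎)
      where
      open ℕ.+-*-Solver using (solve; _:=_; _:*_)
      instance
        p≢0 = prime⇒nonZero prime-p
      p<n = ∈-upTo⁻ p∈n
      factors′ : ∀ {q} → Prime q → q ∣ d ℕ.* p → w ≤ fromℕ q × p ℕ.≤ q
      factors′ {q} prime-q q∣dp with euclidsLemma d p prime-q q∣dp
      ... | inj₁ q∣d = proj₁ (factors prime-q q∣d) , ℕ.≤-trans (ℕ.<⇒≤ p<n) (proj₂ (factors prime-q q∣d))
      ... | inj₂ q∣p with prime⇒irreducible prime-p q∣p
      ...   | inj₁ refl = contradiction prime-q ¬prime[1]
      ...   | inj₂ refl = w≤p , ℕ.≤-refl
      dp∣ : ∀ {a} → (d ∣ a) × (p ∣ a) → d ℕ.* p ∣ a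
      dp∣ (divides b refl , p∣bd) with euclidsLemma b d prime-p p∣bd
      ... | inj₁ p∣b = subst (_∣ b ℕ.* d) (ℕ.*-comm p d) (*-monoˡ-∣ d p∣b)
      ... | inj₂ p∣d = contradiction p<n (ℕ.≤⇒≯ (proj₂ (factors prime-p p∣d)))
      𝟙-∣ : ∀ a → 𝟙 (d ℕ.* p ∣? a) ≡ 𝟙 (d ∣? a) ℕ.* 𝟙 (p ∣? a)
      𝟙-∣ a = trans
        (𝟙-cong (d ℕ.* p ∣? a) (d ∣? a ×-dec p ∣? a)
          (λ dp∣a → ∣-trans (m∣m*n p) dp∣a , ∣-trans (n∣m*n d) dp∣a) dp∣)
        (𝟙-× (d ∣? a) (p ∣? a))

-- Nonnegativity of limits of rational sequences

open +-*-Solver using (Polynomial; solve; con; _:=_; _:+_; _:*_; _:-_; :-_)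

⅓ ¼ : ℚ
⅓ = + 1 ℚ./ 3
¼ = + 1 ℚ./ 4

*-pos : ∀ {p q} → 0ℚ ℚ.< p → 0ℚ ℚ.< q → 0ℚ ℚ.< p ℚ.* q
*-pos {p} {q} 0<p 0<q = ℚ.positive⁻¹ (p ℚ.* q)
  {{ℚ.pos*pos⇒pos p {{ℚ.positive 0<p}} q {{ℚ.positive 0<q}}}}

*-nonNeg : ∀ {p q} → 0ℚ ℚ.≤ p → 0ℚ ℚ.≤ q → 0ℚ ℚ.≤ p ℚ.* q
*-nonNeg {p} {q} 0≤p 0≤q = subst (ℚ._≤ p ℚ.* q) (ℚ.*-zeroʳ p)
  (ℚ.*-monoˡ-≤-nonNeg p {{ℚ.nonNegative 0≤p}} 0≤q)

+-nonNeg : ∀ {p q} → 0ℚ ℚ.≤ p → 0ℚ ℚ.≤ q → 0ℚ ℚ.≤ p ℚ.+ q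
+-nonNeg = ℚ.+-mono-≤

p≤q⇒0≤q-p : ∀ {p q} → p ℚ.≤ q → 0ℚ ℚ.≤ q ℚ.- p
p≤q⇒0≤q-p {p} {q} p≤q = subst (ℚ._≤ q ℚ.- p) (ℚ.+-inverseʳ p) (ℚ.+-monoˡ-≤ (ℚ.- p) p≤q)

0≤q-p⇒p≤q : ∀ {p q} → 0ℚ ℚ.≤ q ℚ.- p → p ℚ.≤ q
0≤q-p⇒p≤q {p} {q} 0≤q-p = subst₂ ℚ._≤_ (ℚ.+-identityʳ p)
  (solve 2 (λ p q → p :+ (q :- p) := q) refl p q) (ℚ.+-monoʳ-≤ p 0≤q-p)

p≤∣p∣ : ∀ p → p ℚ.≤ ℚ.∣ p ∣
p≤∣p∣ p with ℚ.≤-total 0ℚ p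
... | inj₁ 0≤p = ℚ.≤-reflexive (sym (ℚ.0≤p⇒∣p∣≡p 0≤p))
... | inj₂ p≤0 = ℚ.≤-trans p≤0 (ℚ.0≤∣p∣ p)

-- Nonnegativity of the limit, not of the terms.
record NonNegative (s : ℕ → ℚ) : Set where
  field
    eventually : ∀ ε → 0ℚ ℚ.< ε → ∃ λ N → ∀ n → N ℕ.≤ n → 0ℚ ℚ.≤ s n ℚ.+ ε

open NonNegative

NonNegative-cong : ∀ {s t : ℕ → ℚ} N → (∀ n → N ℕ.≤ n → s n ≡ t n) → NonNegative s → NonNegative t
eventually (NonNegative-cong N s≡t s≥0) ε 0<ε = let M , 0≤s = eventually s≥0 ε 0<ε in
  N ℕ.⊔ M , λ n N⊔M≤n → subst (λ p → 0ℚ ℚ.≤ p ℚ.+ ε)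
    (s≡t n (ℕ.m⊔n≤o⇒m≤o N M N⊔M≤n)) (0≤s n (ℕ.m⊔n≤o⇒n≤o N M N⊔M≤n))

pointwise⇒NonNegative : ∀ {s : ℕ → ℚ} → (∀ n → 0ℚ ℚ.≤ s n) → NonNegative s
eventually (pointwise⇒NonNegative 0≤s) ε 0<ε = 0 , λ n _ → +-nonNeg (0≤s n) (ℚ.<⇒≤ 0<ε)

NonNegative-+ : ∀ {s t} → NonNegative s → NonNegative t → NonNegative (λ n → s n ℚ.+ t n)
eventually (NonNegative-+ {s} {t} s≥0 t≥0) ε 0<ε =
  let 0<δ = *-pos 0<ε (ℚ.positive⁻¹ ½)
      M , 0≤s = eventually s≥0 (ε ℚ.* ½) 0<δ
      N , 0≤t = eventually t≥0 (ε ℚ.* ½) 0<δ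
  in M ℕ.⊔ N , λ n M⊔N≤n → subst (0ℚ ℚ.≤_)
    (solve 3 (λ s t e → (s :+ e :* con ½) :+ (t :+ e :* con ½) := s :+ t :+ e) refl (s n) (t n) ε)
    (+-nonNeg (0≤s n (ℕ.m⊔n≤o⇒m≤o M N M⊔N≤n)) (0≤t n (ℕ.m⊔n≤o⇒n≤o M N M⊔N≤n)))

-- With x, y ≥ -δ and x, y ≤ B, the product (x + δ)(y + δ) ≥ 0 gives x y ≥ -δ (2B + δ), so
-- δ ≤ 1 with δ (2B + 1) ≤ ε suffices.
NonNegative-* : ∀ x y → NonNegative (seq x) → NonNegative (seq y) → NonNegative (seq (x * y))
eventually (NonNegative-* x y x≥0 y≥0) ε 0<ε =
  let N₁ , 0≤x = eventually x≥0 δ 0<δ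
      N₂ , 0≤y = eventually y≥0 δ 0<δ
      N₃ , x≤b = bounded x
      N₄ , y≤b = bounded y
  in (N₁ ℕ.⊔ N₂) ℕ.⊔ (N₃ ℕ.⊔ N₄) , λ n N≤n →
    let p = seq x n
        q = seq y n
        N₁₂≤n = ℕ.m⊔n≤o⇒m≤o (N₁ ℕ.⊔ N₂) (N₃ ℕ.⊔ N₄) N≤n
        N₃₄≤n = ℕ.m⊔n≤o⇒n≤o (N₁ ℕ.⊔ N₂) (N₃ ℕ.⊔ N₄) N≤n
        0≤p+δ = 0≤x n (ℕ.m⊔n≤o⇒m≤o N₁ N₂ N₁₂≤n)
        0≤q+δ = 0≤y n (ℕ.m⊔n≤o⇒n≤o N₁ N₂ N₁₂≤n)
        0≤a-p = p≤q⇒0≤q-p (x≤b n (ℕ.m⊔n≤o⇒m≤o N₃ N₄ N₃₄≤n))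
        0≤b-q = p≤q⇒0≤q-p (y≤b n (ℕ.m⊔n≤o⇒n≤o N₃ N₄ N₃₄≤n))
    in subst (0ℚ ℚ.≤_) (trans
         (solve 6 (λ p q a b d e →
             (p :+ d) :* (q :+ d) :+ d :* ((a :- p) :+ (b :- q) :+ (con 1ℚ :- d) :+ e)
             := p :* q :+ d :* (a :+ b :+ con 1ℚ :+ e))
            refl p q (bound x) (bound y) δ ε)
         (cong (p ℚ.* q ℚ.+_) δK≡ε))
       (+-nonNeg (*-nonNeg 0≤p+δ 0≤q+δ)
         (*-nonNeg (ℚ.<⇒≤ 0<δ) (+-nonNeg (+-nonNeg (+-nonNeg 0≤a-p 0≤b-q) 0≤1-δ) (ℚ.<⇒≤ 0<ε))))
  where
  bound : ℝ → ℚ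
  bound x = cast (proj₁ (archimedean x))
  bounded : ∀ x → ∃ λ N → ∀ n → N ℕ.≤ n → seq x n ℚ.≤ bound x
  bounded x = let η , 0<η , N , x+η≤b = proj₂ (archimedean x) in
    N , λ n N≤n → ℚ.≤-trans (ℚ.<⇒≤ (p<p+q (seq x n) 0<η)) (x+η≤b n N≤n)
  0≤bound : ∀ x → 0ℚ ℚ.≤ bound x
  0≤bound x = cast-mono-≤ z≤n
  -- The summand `ε` forces δ = ε / K ≤ 1, while the rest of `K` absorbs the bounds on both factors.
  K = bound x ℚ.+ bound y ℚ.+ 1ℚ ℚ.+ ε
  0<1 : 0ℚ ℚ.< 1ℚ
  0<1 = ℚ.positive⁻¹ 1ℚ
  0≤K-ε : 0ℚ ℚ.≤ bound x ℚ.+ bound y ℚ.+ 1ℚ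
  0≤K-ε = +-nonNeg (+-nonNeg (0≤bound x) (0≤bound y)) (ℚ.<⇒≤ 0<1)
  0<K : 0ℚ ℚ.< K
  0<K = ℚ.+-mono-≤-< 0≤K-ε 0<ε
  δ = ε ℚ.* recip K
  0<δ = *-pos 0<ε (recip-positive K 0<K)
  δK≡ε : δ ℚ.* K ≡ ε
  δK≡ε = trans (solve 3 (λ e r k → e :* r :* k := e :* (k :* r)) refl ε (recip K) K)
    (trans (cong (ε ℚ.*_) (recip-inverse K 0<K)) (ℚ.*-identityʳ ε))
  0≤1-δ : 0ℚ ℚ.≤ 1ℚ ℚ.- δ
  0≤1-δ = subst (0ℚ ℚ.≤_)
    (trans (solve 3 (λ e k r → (k :- e) :* r := k :* r :- e :* r) refl ε K (recip K))
           (cong (ℚ._- δ) (recip-inverse K 0<K)))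
    (*-nonNeg (subst (0ℚ ℚ.≤_) (solve 2 (λ a e → a := a :+ e :- e) refl _ ε) 0≤K-ε)
      (ℚ.<⇒≤ (recip-positive K 0<K)))

-- If the term of y - x at the Cauchy index for ε/3 were below -2ε/3, all later ones would be at
-- most -ε/3, giving `y < x`. So that term is at least -2ε/3 and the later ones at least -ε. The
-- only comparison decided is one of rationals.
≤⇒NonNegative : ∀ x y → x ≤ y → NonNegative (seq (y - x))
eventually (≤⇒NonNegative x y x≤y) ε 0<ε = N , λ n N≤n → subst (0ℚ ℚ.≤_)
  (solve 3 (λ a b e → (a :+ (e :* con ⅓ :+ e :* con ⅓)) :+ (e :* con ⅓ :- (a :- b)) := b :+ e) refl
    (seq d N) (seq d n) ε)
  (+-nonNeg 0≤dN+2δ (p≤q⇒0≤q-p (ℚ.≤-trans (p≤∣p∣ (seq d N ℚ.- seq d n)) (near N n ℕ.≤-refl N≤n))))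
  where
  d    = y - x
  δ    = ε ℚ.* ⅓
  0<δ  = *-pos 0<ε (ℚ.positive⁻¹ ⅓)
  N    = proj₁ (cauchy d δ 0<δ)
  near = proj₂ (cauchy d δ 0<δ)
  0≤dN+2δ : 0ℚ ℚ.≤ seq d N ℚ.+ (δ ℚ.+ δ)
  0≤dN+2δ = ℚ.≮⇒≥ λ dN+2δ<0 → x≤y (δ , 0<δ , N , λ n N≤n → 0≤q-p⇒p≤q (subst (0ℚ ℚ.≤_)
    (solve 4 (λ a x y e → (con 0ℚ :- (a :+ (e :+ e))) :+ (e :- ((y :- x) :- a)) := x :- (y :+ e)) refl
      (seq d N) (seq x n) (seq y n) δ)
    (+-nonNeg (p≤q⇒0≤q-p (ℚ.<⇒≤ dN+2δ<0))
      (p≤q⇒0≤q-p (ℚ.≤-trans (p≤∣p∣ (seq d n ℚ.- seq d N)) (near n N N≤n ℕ.≤-refl))))))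

NonNegative⇒≤ : ∀ x y → NonNegative (seq (y - x)) → x ≤ y
NonNegative⇒≤ x y y-x≥0 (ε , 0<ε , N , y+ε≤x) =
  let M , 0≤ = eventually y-x≥0 (ε ℚ.* ½) (*-pos 0<ε (ℚ.positive⁻¹ ½))
      n = M ℕ.⊔ N
      0≤-ε½ = subst (0ℚ ℚ.≤_)
        (solve 3 (λ x y e → (y :- x :+ e :* con ½) :+ (x :- (y :+ e)) := :- (e :* con ½)) refl (seq x n) (seq y n) ε)
        (+-nonNeg (0≤ n (ℕ.m≤m⊔n M N)) (p≤q⇒0≤q-p (y+ε≤x n (ℕ.m≤n⊔m M N))))
  in ℚ.<-irrefl refl (ℚ.≤-<-trans 0≤-ε½ (ℚ.neg-antimono-< (*-pos 0<ε (ℚ.positive⁻¹ ½))))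

<-≤-trans : ∀ x y z → x < y → y ≤ z → x < z
<-≤-trans x y z (ε , 0<ε , N , x+ε≤y) y≤z =
  let δ = ε ℚ.* ½
      0<δ = *-pos 0<ε (ℚ.positive⁻¹ ½)
      M , 0≤ = eventually (≤⇒NonNegative y z y≤z) δ 0<δ
  in δ , 0<δ , M ℕ.⊔ N , λ n M⊔N≤n → 0≤q-p⇒p≤q (subst (0ℚ ℚ.≤_)
    (solve 4 (λ x y z e → (z :- y :+ e :* con ½) :+ (y :- (x :+ e)) := z :- (x :+ e :* con ½)) refl
      (seq x n) (seq y n) (seq z n) ε)
    (+-nonNeg (0≤ n (ℕ.m⊔n≤o⇒m≤o M N M⊔N≤n)) (p≤q⇒0≤q-p (x+ε≤y n (ℕ.m⊔n≤o⇒n≤o M N M⊔N≤n)))))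

-- Gaps of T and the position of an integer relative to a pair in 𝓤

2∣n⊎2∣1+n : ∀ n → (2 ∣ n) ⊎ (2 ∣ suc n)
2∣n⊎2∣1+n zero          = inj₁ (divides 0 refl)
2∣n⊎2∣1+n (suc zero)    = inj₂ (divides 1 refl)
2∣n⊎2∣1+n (suc (suc n)) with 2∣n⊎2∣1+n n
... | inj₁ (divides k refl) = inj₁ (divides (suc k) refl)
... | inj₂ (divides k eq)   = inj₂ (divides (suc k) (cong (2 ℕ.+_) eq))

2∤consecutive : ∀ {n} → 2 ∣ n → 2 ∤ suc n
2∤consecutive {n} 2∣n 2∣1+n =
  contradiction (∣1⇒≡1 (∣m+n∣m⇒∣n (subst (2 ∣_) (ℕ.+-comm 1 n) 2∣1+n) 2∣n)) λ ()

relax-upper : ∀ x {i j} → i ℕ.≤ j → NonNegative (seq (fromℕ i - x)) → NonNegative (seq (fromℕ j - x))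
relax-upper x {i} {j} i≤j x≤i = NonNegative-cong 0
  (λ n _ → solve 3 (λ x i j → (i :- x) :+ (j :- i) := j :- x) refl (seq x n) (cast i) (cast j))
  (NonNegative-+ x≤i (pointwise⇒NonNegative λ _ → p≤q⇒0≤q-p (cast-mono-≤ i≤j)))

relax-lower : ∀ x {i j} → i ℕ.≤ j → NonNegative (seq (x - fromℕ j)) → NonNegative (seq (x - fromℕ i))
relax-lower x {i} {j} i≤j j≤x = NonNegative-cong 0
  (λ n _ → solve 3 (λ x i j → (x :- j) :+ (j :- i) := x :- i) refl (seq x n) (cast i) (cast j))
  (NonNegative-+ j≤x (pointwise⇒NonNegative λ _ → p≤q⇒0≤q-p (cast-mono-≤ i≤j)))

-- The witness of `x ∈ T` names an interval [i - 1, i] with i odd. If i > j, then i ≥ j + 2 by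
-- parity, so the interval starts at j + 1 or later.
T-gap : ∀ {j} x → 2 ∤ j → x ∈ T → NonNegative (seq (fromℕ j - x)) ⊎ NonNegative (seq (x - fromℕ (suc j)))
T-gap {zero}  x 2∤0 _ = contradiction (divides 0 refl) 2∤0
T-gap {suc j} x 2∤j (inj₁ (_ , x≤1)) = inj₁ (relax-upper x (s≤s z≤n) (≤⇒NonNegative x 1ℝ x≤1))
T-gap {j} x 2∤j (inj₂ (i , _ , 2∤i , i-1≤x , x≤i)) with i ℕ.≤? j
... | yes i≤j = inj₁ (relax-upper x i≤j (≤⇒NonNegative x (fromℕ i) x≤i))
... | no  i≰j = inj₂ (relax-lower x (ℕ.s≤s⁻¹ 2+j≤1+i-1) (NonNegative-cong 0
    (λ n _ → cong (λ p → seq x n ℚ.- p) i-1≡)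
    (≤⇒NonNegative (fromℕ i - 1ℝ) x i-1≤x)))
  where
  2+j≤i : 2 ℕ.+ j ℕ.≤ i
  2+j≤i with 2∣n⊎2∣1+n j
  ... | inj₁ 2∣j   = contradiction 2∣j 2∤j
  ... | inj₂ 2∣1+j = ℕ.≤∧≢⇒< (ℕ.≰⇒> i≰j) λ { refl → 2∤i 2∣1+j }
  i≡1+ : 1 ℕ.+ ℕ.pred i ≡ i
  i≡1+ = ℕ.suc-pred i {{ℕ.>-nonZero (ℕ.≤-trans (s≤s z≤n) 2+j≤i)}}
  2+j≤1+i-1 : 2 ℕ.+ j ℕ.≤ suc (ℕ.pred i)
  2+j≤1+i-1 = subst (2 ℕ.+ j ℕ.≤_) (sym i≡1+) 2+j≤i
  i-1≡ : cast i ℚ.- 1ℚ ≡ cast (ℕ.pred i)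
  i-1≡ = trans (cong (ℚ._- 1ℚ) (trans (cong cast (sym i≡1+)) (cast-+ 1 (ℕ.pred i))))
    (solve 1 (λ k → con 1ℚ :+ k :- con 1ℚ := k) refl (cast (ℕ.pred i)))

SameSide : ℝ → ℝ → ℕ → Set
SameSide x y k = (NonNegative (seq (x - fromℕ k)) × NonNegative (seq (y - fromℕ k)))
               ⊎ (NonNegative (seq (fromℕ k - x)) × NonNegative (seq (fromℕ k - y)))

-- The gap is as long as the distance allowed, so `x` is pinned to j and `y` to j + 1, with no
-- integer strictly between.
sameSide-across-gap : ∀ x y {j} k → NonNegative (seq (x + 1ℝ - y)) →
  NonNegative (seq (fromℕ j - x)) → NonNegative (seq (y - fromℕ (suc j))) → SameSide x y k
sameSide-across-gap x y {j} k y≤x+1 x≤j 1+j≤y with k ℕ.≤? j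
... | yes k≤j = inj₁ (relax-lower x k≤j j≤x , relax-lower y (ℕ.m≤n⇒m≤1+n k≤j) 1+j≤y)
  where
  j≤x : NonNegative (seq (x - fromℕ j))
  j≤x = NonNegative-cong 0
    (λ n _ → trans (cong (λ p → seq x n ℚ.+ 1ℚ ℚ.- seq y n ℚ.+ (seq y n ℚ.- p)) (cast-+ 1 j))
      (solve 3 (λ x y j → (x :+ con 1ℚ :- y) :+ (y :- (con 1ℚ :+ j)) := x :- j) refl (seq x n) (seq y n) (cast j)))
    (NonNegative-+ y≤x+1 1+j≤y)
... | no  k≰j = inj₂ (relax-upper x (ℕ.<⇒≤ (ℕ.≰⇒> k≰j)) x≤j , relax-upper y (ℕ.≰⇒> k≰j) y≤1+j)
  where
  y≤1+j : NonNegative (seq (fromℕ (suc j) - y))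
  y≤1+j = NonNegative-cong 0
    (λ n _ → trans
      (solve 3 (λ x y j → (x :+ con 1ℚ :- y) :+ (j :- x) := (con 1ℚ :+ j) :- y) refl (seq x n) (seq y n) (cast j))
      (cong (ℚ._- seq y n) (sym (cast-+ 1 j))))
    (NonNegative-+ y≤x+1 x≤j)

-- Makes `k` an endpoint of a gap of `T`: the lower one if `k` is odd, the upper one if it is even.
nearby-odd : ∀ k → 1 ℕ.≤ k → ∃ λ j → 2 ∤ j × j ℕ.≤ k × k ℕ.≤ suc j
nearby-odd (suc k) _ with 2∣n⊎2∣1+n k
... | inj₁ 2∣k   = suc k , (λ 2∣1+k → 2∤consecutive 2∣k 2∣1+k) , ℕ.≤-refl , ℕ.n≤1+n _
... | inj₂ 2∣1+k = k , (λ 2∣k → 2∤consecutive 2∣k 2∣1+k) , ℕ.n≤1+n _ , ℕ.≤-refl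

𝓤⇒sameSide : ∀ x y k → (x , y) ∈ 𝓤 → 1 ℕ.≤ k → SameSide x y k
𝓤⇒sameSide x y k (x∈T , y∈T , ∣x-y∣≤1) 1≤k
  with j , 2∤j , j≤k , k≤1+j ← nearby-odd k 1≤k
  with T-gap x 2∤j x∈T | T-gap y 2∤j y∈T
... | inj₁ x≤j   | inj₁ y≤j   = inj₂ (relax-upper x j≤k x≤j , relax-upper y j≤k y≤j)
... | inj₂ 1+j≤x | inj₂ 1+j≤y = inj₁ (relax-lower x k≤1+j 1+j≤x , relax-lower y k≤1+j 1+j≤y)
... | inj₁ x≤j   | inj₂ 1+j≤y = sameSide-across-gap x y k y≤x+1 x≤j 1+j≤y
  where
  y≤x+1 : NonNegative (seq (x + 1ℝ - y))
  y≤x+1 = NonNegative-cong 0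
    (λ n _ → solve 3 (λ x y a → (con 1ℚ :- a) :+ (a :- :- (x :- y)) := x :+ con 1ℚ :- y) refl
      (seq x n) (seq y n) ℚ.∣ seq x n ℚ.- seq y n ∣)
    (NonNegative-+ (≤⇒NonNegative ∣ x - y ∣ 1ℝ ∣x-y∣≤1)
      (pointwise⇒NonNegative λ n → p≤q⇒0≤q-p (subst (ℚ.- (seq x n ℚ.- seq y n) ℚ.≤_)
        (ℚ.∣-p∣≡∣p∣ (seq x n ℚ.- seq y n)) (p≤∣p∣ (ℚ.- (seq x n ℚ.- seq y n))))))
... | inj₂ 1+j≤x | inj₁ y≤j   = Sum.map swap swap (sameSide-across-gap y x k x≤y+1 y≤j 1+j≤x)
  where
  x≤y+1 : NonNegative (seq (y + 1ℝ - x))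
  x≤y+1 = NonNegative-cong 0
    (λ n _ → solve 3 (λ x y a → (con 1ℚ :- a) :+ (a :- (x :- y)) := y :+ con 1ℚ :- x) refl
      (seq x n) (seq y n) ℚ.∣ seq x n ℚ.- seq y n ∣)
    (NonNegative-+ (≤⇒NonNegative ∣ x - y ∣ 1ℝ ∣x-y∣≤1)
      (pointwise⇒NonNegative λ n → p≤q⇒0≤q-p (p≤∣p∣ (seq x n ℚ.- seq y n))))

𝓤⇒product-nonNegative : ∀ x y k → (x , y) ∈ 𝓤 → 1 ℕ.≤ k →
                         NonNegative (seq ((x - fromℕ k) * (y - fromℕ k)))
𝓤⇒product-nonNegative x y k xy∈𝓤 1≤k with 𝓤⇒sameSide x y k xy∈𝓤 1≤k
... | inj₁ (k≤x , k≤y) = NonNegative-* (x - fromℕ k) (y - fromℕ k) k≤x k≤y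
... | inj₂ (x≤k , y≤k) = NonNegative-cong 0
  (λ n _ → solve 3 (λ x y k → (k :- x) :* (k :- y) := (x :- k) :* (y :- k)) refl (seq x n) (seq y n) (cast k))
  (NonNegative-* (fromℕ k - x) (fromℕ k - y) x≤k y≤k)

-- Binomial coefficients as polynomials and the origin of the coefficients

-- The rule (r + 1) C(n, r + 1) = (n - r) C(n, r) with the subtraction moved across, so that it
-- holds in ℕ even for r > n; Pascal's rule proves it.
absorption : ∀ n r → n ℕ.* (n C r) ≡ suc r ℕ.* (n C suc r) ℕ.+ r ℕ.* (n C r)
absorption zero zero    = refl
absorption zero (suc r) = sym (cong₂ ℕ._+_ (ℕ.*-zeroʳ r) (ℕ.*-zeroʳ r))
absorption (suc n) zero = trans (ℕ.*-identityʳ (suc n)) (sym (trans (ℕ.+-identityʳ _)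
  (trans (ℕ.*-identityˡ _) (nC1≡n (suc n)))))
absorption (suc n) (suc r) = begin
  suc n ℕ.* (suc n C suc r)
    ≡⟨ cong (suc n ℕ.*_) (sym (nCk+nC[k+1]≡[n+1]C[k+1] n r)) ⟩
  suc n ℕ.* (a ℕ.+ b)
    ≡⟨ S.solve 3 (λ n a b → (S.con 1 S.:+ n) S.:* (a S.:+ b) S.:= n S.:* a S.:+ n S.:* b S.:+ a S.:+ b) refl n a b ⟩
  n ℕ.* a ℕ.+ n ℕ.* b ℕ.+ a ℕ.+ b
    ≡⟨ cong₂ (λ u v → u ℕ.+ v ℕ.+ a ℕ.+ b) (absorption n r) (absorption n (suc r)) ⟩
  suc r ℕ.* b ℕ.+ r ℕ.* a ℕ.+ (suc (suc r) ℕ.* d ℕ.+ suc r ℕ.* b) ℕ.+ a ℕ.+ b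
    ≡⟨ S.solve 4 (λ r a b d →
         (S.con 1 S.:+ r) S.:* b S.:+ r S.:* a S.:+ ((S.con 2 S.:+ r) S.:* d S.:+ (S.con 1 S.:+ r) S.:* b) S.:+ a S.:+ b
         S.:= (S.con 2 S.:+ r) S.:* (b S.:+ d) S.:+ (S.con 1 S.:+ r) S.:* (a S.:+ b)) refl r a b d ⟩
  suc (suc r) ℕ.* (b ℕ.+ d) ℕ.+ suc r ℕ.* (a ℕ.+ b)
    ≡⟨ cong₂ (λ u v → suc (suc r) ℕ.* u ℕ.+ suc r ℕ.* v)
         (nCk+nC[k+1]≡[n+1]C[k+1] n (suc r)) (nCk+nC[k+1]≡[n+1]C[k+1] n r) ⟩
  suc (suc r) ℕ.* (suc n C suc (suc r)) ℕ.+ suc r ℕ.* (suc n C suc r) ∎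
  where
  open ≡-Reasoning
  module S = ℕ.+-*-Solver
  a = n C r
  b = n C suc r
  d = n C suc (suc r)

-- `absorption` solved for the next binomial coefficient, `q` being 1/(r + 1). Iterated, it turns
-- C(c, 2), C(c, 3) and C(c, 4) into polynomials in c for the ring solver.
cast-C-suc : ∀ n r q → cast (suc r) ℚ.* q ≡ 1ℚ →
             cast (n C suc r) ≡ q ℚ.* ((cast n ℚ.- cast r) ℚ.* cast (n C r))
cast-C-suc n r q rq≡1 = begin
  y
    ≡⟨ sym (ℚ.*-identityˡ y) ⟩
  1ℚ ℚ.* y
    ≡⟨ cong (ℚ._* y) (sym rq≡1) ⟩
  cast (suc r) ℚ.* q ℚ.* y
    ≡⟨ solve 5 (λ s q y r x → s :* q :* y := q :* ((s :* y :+ r :* x) :- r :* x)) refl (cast (suc r)) q y (cast r) x ⟩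
  q ℚ.* ((cast (suc r) ℚ.* y ℚ.+ cast r ℚ.* x) ℚ.- cast r ℚ.* x)
    ≡⟨ cong (λ t → q ℚ.* (t ℚ.- cast r ℚ.* x)) (sym absorptionℚ) ⟩
  q ℚ.* (cast n ℚ.* x ℚ.- cast r ℚ.* x)
    ≡⟨ solve 4 (λ q n r x → q :* (n :* x :- r :* x) := q :* ((n :- r) :* x)) refl q (cast n) (cast r) x ⟩
  q ℚ.* ((cast n ℚ.- cast r) ℚ.* x) ∎
  where
  open ≡-Reasoning
  x = cast (n C r)
  y = cast (n C suc r)
  absorptionℚ : cast n ℚ.* x ≡ cast (suc r) ℚ.* y ℚ.+ cast r ℚ.* x
  absorptionℚ = begin
    cast n ℚ.* x                                              ≡⟨ sym (cast-* n (n C r)) ⟩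
    cast (n ℕ.* (n C r))                                      ≡⟨ cong cast (absorption n r) ⟩
    cast (suc r ℕ.* (n C suc r) ℕ.+ r ℕ.* (n C r))            ≡⟨ cast-+ (suc r ℕ.* (n C suc r)) (r ℕ.* (n C r)) ⟩
    cast (suc r ℕ.* (n C suc r)) ℚ.+ cast (r ℕ.* (n C r))     ≡⟨ cong₂ ℚ._+_ (cast-* (suc r) (n C suc r)) (cast-* r (n C r)) ⟩
    cast (suc r) ℚ.* y ℚ.+ cast r ℚ.* x                       ∎

-- On an explicit list, the n-th term of `esym` unfolds to this function of the n-th terms.
esymℚ : ℕ → List ℚ → ℚ
esymℚ r xs = foldr ℚ._+_ 0ℚ (map (foldr ℚ._*_ 1ℚ) (choose r xs))

combination : (k x : ℕ → ℚ) → ℚ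
combination k x = x 0 ℚ.- k 1 ℚ.* x 1 ℚ.+ k 2 ℚ.* x 2 ℚ.- k 3 ℚ.* x 3 ℚ.+ k 4 ℚ.* x 4

-- The coefficients of the theorem, with ρ in place of 1/P; the last clause is never used.
coefficient : List ℚ → ℚ → ℕ → ℚ
coefficient qs ρ 1 = (esymℚ 3 qs ℚ.- esymℚ 2 qs ℚ.+ esymℚ 1 qs ℚ.- cast 1) ℚ.* ρ
coefficient qs ρ 2 = (cast 2 ℚ.* (esymℚ 2 qs ℚ.- cast 3 ℚ.* esymℚ 1 qs ℚ.+ cast 7)) ℚ.* ρ
coefficient qs ρ 3 = (cast 6 ℚ.* (esymℚ 1 qs ℚ.- cast 6)) ℚ.* ρ
coefficient qs ρ 4 = cast 24 ℚ.* ρ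
coefficient qs ρ _ = 1ℚ

combination-cong : ∀ k {x y : ℕ → ℚ} → (∀ r → x r ≡ y r) → combination k x ≡ combination k y
combination-cong k eq = cong₂ ℚ._+_
  (cong₂ ℚ._-_
    (cong₂ ℚ._+_ (cong₂ ℚ._-_ (eq 0) (cong (k 1 ℚ.*_) (eq 1))) (cong (k 2 ℚ.*_) (eq 2)))
    (cong (k 3 ℚ.*_) (eq 3)))
  (cong (k 4 ℚ.*_) (eq 4))

-- Newton's forward-difference expansion at 0 of the quartic in c on the right. The r-th difference
-- of c^m at 0 is r! times a Stirling number of the second kind: 2, 6, 14 for r = 2, then 6, 36 for
-- r = 3, and 24, whence the constants 3, 7 and 6 beside the factors 2, 6 and 24.
combination-C : ∀ q₁ q₂ q₃ q₄ ρ c → q₁ ℚ.* q₂ ℚ.* q₃ ℚ.* q₄ ℚ.* ρ ≡ 1ℚ →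
  combination (coefficient (q₁ ∷ q₂ ∷ q₃ ∷ q₄ ∷ []) ρ) (λ r → cast (c C r)) ≡
  (q₁ ℚ.- cast c) ℚ.* (q₂ ℚ.- cast c) ℚ.* ((q₃ ℚ.- cast c) ℚ.* (q₄ ℚ.- cast c)) ℚ.* ρ
combination-C q₁ q₂ q₃ q₄ ρ c Pρ≡1 = begin
  1ℚ ℚ.- k 1 ℚ.* cast (c C 1) ℚ.+ k 2 ℚ.* cast (c C 2) ℚ.- k 3 ℚ.* cast (c C 3) ℚ.+ k 4 ℚ.* cast (c C 4)
    ≡⟨ cong₂ ℚ._+_
         (cong₂ ℚ._-_ (cong₂ (λ u v → 1ℚ ℚ.- k 1 ℚ.* u ℚ.+ k 2 ℚ.* v) C₁ C₂) (cong (k 3 ℚ.*_) C₃))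
         (cong (k 4 ℚ.*_) C₄) ⟩
  1ℚ ℚ.- k 1 ℚ.* n ℚ.+ k 2 ℚ.* c₂ ℚ.- k 3 ℚ.* c₃ ℚ.+ k 4 ℚ.* c₄
    ≡⟨ solve 6 (λ q₁ q₂ q₃ q₄ ρ n →
         -- `choose` acts on the solver's variables, so the meaning of `M r` unfolds to `esymℚ r`.
         let M : ℕ → Polynomial 6
             M r = foldr _:+_ (con 0ℚ) (map (foldr _:*_ (con 1ℚ)) (choose r (q₁ ∷ q₂ ∷ q₃ ∷ q₄ ∷ [])))
             c₂ = con ½ :* ((n :- con 1ℚ) :* n)
             c₃ = con ⅓ :* ((n :- con (cast 2)) :* c₂)
             c₄ = con ¼ :* ((n :- con (cast 3)) :* c₃)
         in con 1ℚ :- (M 3 :- M 2 :+ M 1 :- con (cast 1)) :* ρ :* n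
              :+ con (cast 2) :* (M 2 :- con (cast 3) :* M 1 :+ con (cast 7)) :* ρ :* c₂
              :- con (cast 6) :* (M 1 :- con (cast 6)) :* ρ :* c₃
              :+ con (cast 24) :* ρ :* c₄
            := (q₁ :- n) :* (q₂ :- n) :* ((q₃ :- n) :* (q₄ :- n)) :* ρ :+ (con 1ℚ :- q₁ :* q₂ :* q₃ :* q₄ :* ρ))
         refl q₁ q₂ q₃ q₄ ρ n ⟩
  -- At c = 0 the combination is 1 but `Π` is Pρ; a polynomial identity cannot use Pρ = 1, so the
  -- defect is carried as a summand.
  Π ℚ.+ (1ℚ ℚ.- q₁ ℚ.* q₂ ℚ.* q₃ ℚ.* q₄ ℚ.* ρ)
    ≡⟨ cong (λ t → Π ℚ.+ (1ℚ ℚ.- t)) Pρ≡1 ⟩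
  Π ℚ.+ 0ℚ
    ≡⟨ ℚ.+-identityʳ Π ⟩
  Π ∎
  where
  open ≡-Reasoning
  qs = q₁ ∷ q₂ ∷ q₃ ∷ q₄ ∷ []
  k = coefficient qs ρ
  n = cast c
  Π = (q₁ ℚ.- n) ℚ.* (q₂ ℚ.- n) ℚ.* ((q₃ ℚ.- n) ℚ.* (q₄ ℚ.- n)) ℚ.* ρ
  c₂ = ½ ℚ.* ((n ℚ.- 1ℚ) ℚ.* n)
  c₃ = ⅓ ℚ.* ((n ℚ.- cast 2) ℚ.* c₂)
  c₄ = ¼ ℚ.* ((n ℚ.- cast 3) ℚ.* c₃)
  C₁ : cast (c C 1) ≡ n
  C₁ = cong cast (nC1≡n c)
  C₂ : cast (c C 2) ≡ c₂
  C₂ = trans (cast-C-suc c 1 ½ refl) (cong (λ t → ½ ℚ.* ((n ℚ.- 1ℚ) ℚ.* t)) C₁)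
  C₃ : cast (c C 3) ≡ c₃
  C₃ = trans (cast-C-suc c 2 ⅓ refl) (cong (λ t → ⅓ ℚ.* ((n ℚ.- cast 2) ℚ.* t)) C₂)
  C₄ : cast (c C 4) ≡ c₄
  C₄ = trans (cast-C-suc c 3 ¼ refl) (cong (λ t → ¼ ℚ.* ((n ℚ.- cast 3) ℚ.* t)) C₃)

-- The combination is linear in the sums, and its coefficients depend on the index n but not on the
-- element; so the inequality may be checked element by element.
NonNegative-∑ : ∀ (k : ℕ → ℕ → ℚ) (x : ℕ → ℕ → ℕ) (y : ℕ → ℕ) as →
  (∀ a → NonNegative (λ n → combination (k n) (λ r → cast (x r a)) ℚ.- cast (y a))) →
  NonNegative (λ n → combination (k n) (λ r → cast (∑ as (x r))) ℚ.- cast (∑ as y))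
NonNegative-∑ k x y [] _ = NonNegative-cong 0
  (λ n _ → solve 4 (λ k₁ k₂ k₃ k₄ → con 0ℚ :=
      con 0ℚ :- k₁ :* con 0ℚ :+ k₂ :* con 0ℚ :- k₃ :* con 0ℚ :+ k₄ :* con 0ℚ :- con 0ℚ) refl
    (k n 1) (k n 2) (k n 3) (k n 4))
  (pointwise⇒NonNegative λ _ → ℚ.≤-refl)
NonNegative-∑ k x y (a ∷ as) termwise = NonNegative-cong 0
  (λ n _ → trans
    (combination-+ (k n) (λ r → cast (x r a)) (λ r → cast (∑ as (x r))) (cast (y a)) (cast (∑ as y)))
    (sym (cong₂ ℚ._-_ (combination-cong (k n) λ r → cast-+ (x r a) (∑ as (x r))) (cast-+ (y a) (∑ as y)))))
  (NonNegative-+ (termwise a) (NonNegative-∑ k x y as termwise))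
  where
  combination-+ : ∀ k u v s t → (combination k u ℚ.- s) ℚ.+ (combination k v ℚ.- t) ≡
                  combination k (λ r → u r ℚ.+ v r) ℚ.- (s ℚ.+ t)
  combination-+ k u v s t =
    solve 16 (λ k₁ k₂ k₃ k₄ u₀ u₁ u₂ u₃ u₄ v₀ v₁ v₂ v₃ v₄ s t →
      (u₀ :- k₁ :* u₁ :+ k₂ :* u₂ :- k₃ :* u₃ :+ k₄ :* u₄ :- s) :+
      (v₀ :- k₁ :* v₁ :+ k₂ :* v₂ :- k₃ :* v₃ :+ k₄ :* v₄ :- t) :=
      (u₀ :+ v₀) :- k₁ :* (u₁ :+ v₁) :+ k₂ :* (u₂ :+ v₂) :- k₃ :* (u₃ :+ v₃) :+ k₄ :* (u₄ :+ v₄) :- (s :+ t))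
    refl (k 1) (k 2) (k 3) (k 4) (u 0) (u 1) (u 2) (u 3) (u 4) (v 0) (v 1) (v 2) (v 3) (v 4) s t

-- The contribution of a single element

module _ (m₁ m₂ m₃ m₄ : ℝ) (m₁₂∈𝓤 : (m₁ , m₂) ∈ 𝓤) (m₃₄∈𝓤 : (m₃ , m₄) ∈ 𝓤) where

  private
    P : ℝ
    P = m₁ * m₂ * m₃ * m₄

    P>0 : 0ℝ < P
    P>0 = 𝓤⇒product-positive m₁ m₂ m₃ m₄ m₁₂∈𝓤 m₃₄∈𝓤

  coefficients : ℕ → ℕ → ℚ
  coefficients n = coefficient (seq m₁ n ∷ seq m₂ n ∷ seq m₃ n ∷ seq m₄ n ∷ []) (recip (seq P n))

  P-eventually-positive : ∃ λ N → ∀ n → N ℕ.≤ n → 0ℚ ℚ.< seq P n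
  P-eventually-positive = let ε , 0<ε , N , 0+ε≤P = P>0 in
    N , λ n N≤n → ℚ.<-≤-trans (p<p+q 0ℚ 0<ε) (0+ε≤P n N≤n)

  private
    N : ℕ
    N = proj₁ P-eventually-positive

    Pρ≡1 : ∀ n → N ℕ.≤ n → seq P n ℚ.* recip (seq P n) ≡ 1ℚ
    Pρ≡1 n N≤n = recip-inverse (seq P n) (proj₂ P-eventually-positive n N≤n)

    combination-C-eventually : ∀ c n → N ℕ.≤ n → combination (coefficients n) (λ r → cast (c C r)) ≡
      (seq m₁ n ℚ.- cast c) ℚ.* (seq m₂ n ℚ.- cast c) ℚ.*
      ((seq m₃ n ℚ.- cast c) ℚ.* (seq m₄ n ℚ.- cast c)) ℚ.* recip (seq P n)
    combination-C-eventually c n N≤n =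
      combination-C (seq m₁ n) (seq m₂ n) (seq m₃ n) (seq m₄ n) (recip (seq P n)) c (Pρ≡1 n N≤n)

    combination-C-0 : ∀ n → N ℕ.≤ n → combination (coefficients n) (λ r → cast (0 C r)) ≡ 1ℚ
    combination-C-0 n N≤n = trans (combination-C-eventually 0 n N≤n)
      (trans (solve 5 (λ a b c d ρ →
                (a :- con 0ℚ) :* (b :- con 0ℚ) :* ((c :- con 0ℚ) :* (d :- con 0ℚ)) :* ρ := a :* b :* c :* d :* ρ)
              refl (seq m₁ n) (seq m₂ n) (seq m₃ n) (seq m₄ n) (recip (seq P n)))
             (Pρ≡1 n N≤n))

  recip-nonNegative : NonNegative (λ n → recip (seq P n))
  eventually recip-nonNegative ε 0<ε = N , λ n N≤n →
    +-nonNeg (ℚ.<⇒≤ (recip-positive (seq P n) (proj₂ P-eventually-positive n N≤n))) (ℚ.<⇒≤ 0<ε)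

  combination-C-nonNegative : ∀ c → 1 ℕ.≤ c →
    NonNegative (λ n → combination (coefficients n) (λ r → cast (c C r)))
  combination-C-nonNegative c 1≤c = NonNegative-cong N
    (λ n N≤n → trans
      (cong ((seq m₁ n ℚ.- cast c) ℚ.* (seq m₂ n ℚ.- cast c) ℚ.*
             ((seq m₃ n ℚ.- cast c) ℚ.* (seq m₄ n ℚ.- cast c)) ℚ.*_) (ℚ.*-identityˡ (recip (seq P n))))
      (sym (combination-C-eventually c n N≤n)))
    -- Products need bounded factors, so 1/P enters as a real, whose terms carry an extra factor 1.
    (NonNegative-* (x * y) (1ℝ / P [ P>0 ])
      (NonNegative-* x y (𝓤⇒product-nonNegative m₁ m₂ c m₁₂∈𝓤 1≤c) (𝓤⇒product-nonNegative m₃ m₄ c m₃₄∈𝓤 1≤c))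
      (NonNegative-cong 0 (λ n _ → sym (ℚ.*-identityˡ (recip (seq P n)))) recip-nonNegative))
    where
    x = (m₁ - fromℕ c) * (m₂ - fromℕ c)
    y = (m₃ - fromℕ c) * (m₄ - fromℕ c)

  -- `Q` stands for roughness at `w`, `R` at `z`. Without `Q` both sides vanish; with `R` the
  -- difference is 1 - 1; otherwise nothing is subtracted from a combination that is 1 for c = 0 and
  -- nonnegative for c ≥ 1.
  summand-nonNegative : {Q R : Set} (q? : Dec Q) (r? : Dec R) (c : ℕ) → (R → Q × c ≡ 0) →
    NonNegative (λ n → combination (coefficients n) (λ r → cast (𝟙 q? ℕ.* (c C r))) ℚ.- cast (𝟙 r?))
  summand-nonNegative (no ¬q) (yes r) c R⇒ = contradiction (proj₁ (R⇒ r)) ¬q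
  summand-nonNegative (no ¬q) (no ¬r) c R⇒ = NonNegative-cong 0
    (λ n _ → solve 4 (λ k₁ k₂ k₃ k₄ → con 0ℚ :=
        con 0ℚ :- k₁ :* con 0ℚ :+ k₂ :* con 0ℚ :- k₃ :* con 0ℚ :+ k₄ :* con 0ℚ :- con 0ℚ) refl
      (coefficients n 1) (coefficients n 2) (coefficients n 3) (coefficients n 4))
    (pointwise⇒NonNegative λ _ → ℚ.≤-refl)
  summand-nonNegative (yes q) r? c R⇒ = NonNegative-cong 0
    (λ n _ → cong (ℚ._- cast (𝟙 r?)) (combination-cong (coefficients n)
      λ r → cong cast (sym (ℕ.*-identityˡ (c C r)))))
    (rough r? c R⇒)
    where
    rough : ∀ {Q R : Set} (r? : Dec R) c → (R → Q × c ≡ 0) →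
      NonNegative (λ n → combination (coefficients n) (λ r → cast (c C r)) ℚ.- cast (𝟙 r?))
    rough (yes r) c       R⇒ with _ , refl ← R⇒ r = NonNegative-cong N
      (λ n N≤n → cong (ℚ._- 1ℚ) (sym (combination-C-0 n N≤n)))
      (pointwise⇒NonNegative λ _ → ℚ.≤-refl)
    rough (no ¬r) zero    R⇒ = NonNegative-cong N
      (λ n N≤n → cong (ℚ._- 0ℚ) (sym (combination-C-0 n N≤n)))
      (pointwise⇒NonNegative λ _ → ℚ.<⇒≤ (ℚ.positive⁻¹ 1ℚ))
    rough (no ¬r) (suc c) R⇒ = NonNegative-cong 0
      (λ n _ → sym (ℚ.+-identityʳ _))
      (combination-C-nonNegative (suc c) (s≤s z≤n))

  private
    M : ℕ → ℝ
    M r = esym r (m₁ ∷ m₂ ∷ m₃ ∷ m₄ ∷ [])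

  -- The sums enter through equations: unifying two reals that contain different sums would
  -- unfold their Cauchy proofs.
  combination-bound : ∀ Y (X : ℕ → ℕ) {Y′ X₀ X₁ X₂ X₃ X₄} →
    Y ≡ Y′ → X 0 ≡ X₀ → X 1 ≡ X₁ → X 2 ≡ X₂ → X 3 ≡ X₃ → X 4 ≡ X₄ →
    NonNegative (λ n → combination (coefficients n) (λ r → cast (X r)) ℚ.- cast Y) →
    fromℕ Y′ ≤
      fromℕ X₀
      - (M 3 - M 2 + M 1 - fromℕ 1) / P [ P>0 ] * fromℕ X₁
      + (fromℕ 2 * (M 2 - fromℕ 3 * M 1 + fromℕ 7)) / P [ P>0 ] * fromℕ X₂
      - (fromℕ 6 * (M 1 - fromℕ 6)) / P [ P>0 ] * fromℕ X₃
      + fromℕ 24 / P [ P>0 ] * fromℕ X₄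
  combination-bound Y X refl refl refl refl refl refl = NonNegative⇒≤ (fromℕ Y)
    (fromℕ (X 0)
      - (M 3 - M 2 + M 1 - fromℕ 1) / P [ P>0 ] * fromℕ (X 1)
      + (fromℕ 2 * (M 2 - fromℕ 3 * M 1 + fromℕ 7)) / P [ P>0 ] * fromℕ (X 2)
      - (fromℕ 6 * (M 1 - fromℕ 6)) / P [ P>0 ] * fromℕ (X 3)
      + fromℕ 24 / P [ P>0 ] * fromℕ (X 4))

-- The sums of the theorem and the final inequality

module _ (em : ExcludedMiddle 0ℓ) (w z : ℝ) where

  open Sieve em
  open Equivalence

  sieveDivisors : ℕ → ℕ
  sieveDivisors a = count (divides? em w a) (proj₁ (ceiling em z))

  rough-C : ℕ → ℕ → ℕ
  rough-C r a = 𝟙 (rough? em w a) ℕ.* (sieveDivisors a C r)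

  -- Starting from p instead of 1 * p, and from `𝒜` instead of `𝒜 ⟨ 1 ⟩`, lets this unfold to the
  -- very sums of the theorem.
  primeSum : FiniteSet⁺ → ℕ → ℕ
  primeSum 𝒜 zero    = S 𝒜 w
  primeSum 𝒜 (suc r) = ∑[ p ∈ primes[ w , z ⟩ ] iterated em w 𝒜 r (fromℕ p) p

  primeSum-∑ : ∀ 𝒜 r → primeSum 𝒜 r ≡ ∑ (elements 𝒜) (rough-C r)
  primeSum-∑ 𝒜 zero = trans (length-filter-∑ (rough? em w) (elements 𝒜))
    (∑-cong (elements 𝒜) λ _ → sym (ℕ.*-identityʳ _))
  primeSum-∑ 𝒜 (suc r) = begin
    ∑[ p ∈ primes[ w , z ⟩ ] iterated em w 𝒜 r (fromℕ p) p
      ≡⟨ ∑-cong primes[ w , z ⟩ (λ {p} _ → cong (iterated em w 𝒜 r (fromℕ p)) (sym (ℕ.*-identityˡ p))) ⟩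
    iterated em w 𝒜 (suc r) z 1
      ≡⟨ iterated-∑ em w 𝒜 (suc r) {z} {proj₁ (ceiling em z)} 1 (proj₂ (ceiling em z)) (λ prime-q q∣1 →
           contradiction (subst Prime (∣1⇒≡1 q∣1) prime-q) ¬prime[1]) ⟩
    ∑[ a ∈ elements 𝒜 ] 𝟙 (rough? em w a) ℕ.* 𝟙 (1 ∣? a) ℕ.* (sieveDivisors a C suc r)
      ≡⟨ ∑-cong (elements 𝒜) (λ {a} _ → cong (ℕ._* (sieveDivisors a C suc r)) (*-𝟙-1∣ (𝟙 (rough? em w a)) a)) ⟩
    ∑[ a ∈ elements 𝒜 ] rough-C (suc r) a ∎
    where
    open ≡-Reasoning
    *-𝟙-1∣ : ∀ n a → n ℕ.* 𝟙 (1 ∣? a) ≡ n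
    *-𝟙-1∣ n a = trans (cong (n ℕ.*_) (𝟙-cong (1 ∣? a) (yes (1∣ a)) (λ _ → 1∣ a) λ 1∣a → 1∣a)) (ℕ.*-identityʳ n)

  sieveDivisors≡0 : ∀ a → Rough em z a → sieveDivisors a ≡ 0
  sieveDivisors≡0 a z-rough = length≡0 λ p∈ →
    let p∈Z , (prime-p , _) , p∣a = ∈-filter⁻ (divides? em w a) {xs = upTo (proj₁ (ceiling em z))} p∈
    in z-rough (_ , prime-p , p∣a , from (proj₂ (ceiling em z) _) (∈-upTo⁻ p∈Z))
    where
    length≡0 : ∀ {ps : List ℕ} → (∀ {p} → ¬ (p ∈ˡ ps)) → length ps ≡ 0
    length≡0 {[]}     _ = refl
    length≡0 {p ∷ ps} ∉ = contradiction (here refl) ∉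

  rough-antitone : w ≤ z → ∀ {a} → Rough em z a → Rough em w a
  rough-antitone w≤z z-rough (q , prime-q , q∣a , q<w) =
    z-rough (q , prime-q , q∣a , <-≤-trans (fromℕ q) w z q<w w≤z)

theorem3 :
    (em : ExcludedMiddle 0ℓ) → let open Sieve em in
    (𝒜 : FiniteSet⁺) (w z : ℝ) → w ≤ z →
    (m₁ m₂ m₃ m₄ : ℝ)
    (m₁₂∈𝓤 : (m₁ , m₂) ∈ 𝓤) (m₃₄∈𝓤 : (m₃ , m₄) ∈ 𝓤) →
    let M : ℕ → ℝ
        M r = esym r (m₁ ∷ m₂ ∷ m₃ ∷ m₄ ∷ [])
        P : ℝ
        P = m₁ * m₂ * m₃ * m₄
        P>0 : 0ℝ < P
        P>0 = 𝓤⇒product-positive m₁ m₂ m₃ m₄ m₁₂∈𝓤 m₃₄∈𝓤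
    in
    fromℕ (S 𝒜 z) ≤
      fromℕ (S 𝒜 w)
      - (M 3 - M 2 + M 1 - fromℕ 1) / P [ P>0 ]
        * fromℕ (∑[ p₁ ∈ primes[ w , z ⟩ ] S (𝒜 ⟨ p₁ ⟩) w)
      + (fromℕ 2 * (M 2 - fromℕ 3 * M 1 + fromℕ 7)) / P [ P>0 ]
        * fromℕ (∑[ p₁ ∈ primes[ w , z ⟩ ] ∑[ p₂ ∈ primes[ w , fromℕ p₁ ⟩ ] S (𝒜 ⟨ p₁ ℕ.* p₂ ⟩) w)
      - (fromℕ 6 * (M 1 - fromℕ 6)) / P [ P>0 ]
        * fromℕ (∑[ p₁ ∈ primes[ w , z ⟩ ] ∑[ p₂ ∈ primes[ w , fromℕ p₁ ⟩ ] ∑[ p₃ ∈ primes[ w , fromℕ p₂ ⟩ ] S (𝒜 ⟨ p₁ ℕ.* p₂ ℕ.* p₃ ⟩) w)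
      + fromℕ 24 / P [ P>0 ]
        * fromℕ (∑[ p₁ ∈ primes[ w , z ⟩ ] ∑[ p₂ ∈ primes[ w , fromℕ p₁ ⟩ ] ∑[ p₃ ∈ primes[ w , fromℕ p₂ ⟩ ] ∑[ p₄ ∈ primes[ w , fromℕ p₃ ⟩ ] S (𝒜 ⟨ p₁ ℕ.* p₂ ℕ.* p₃ ℕ.* p₄ ⟩) w)
theorem3 em 𝒜 w z w≤z m₁ m₂ m₃ m₄ m₁₂∈𝓤 m₃₄∈𝓤 =
  combination-bound m₁ m₂ m₃ m₄ m₁₂∈𝓤 m₃₄∈𝓤
    (∑ (elements 𝒜) (𝟙 ∘ rough? em z)) (λ r → ∑ (elements 𝒜) (rough-C em w z r))
    (sym (length-filter-∑ (rough? em z) (elements 𝒜)))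
    (∑≡primeSum 0) (∑≡primeSum 1) (∑≡primeSum 2) (∑≡primeSum 3) (∑≡primeSum 4)
    (NonNegative-∑
      (coefficients m₁ m₂ m₃ m₄ m₁₂∈𝓤 m₃₄∈𝓤) (rough-C em w z) (𝟙 ∘ rough? em z) (elements 𝒜)
      λ a → summand-nonNegative m₁ m₂ m₃ m₄ m₁₂∈𝓤 m₃₄∈𝓤
        (rough? em w a) (rough? em z a) (sieveDivisors em w z a)
        -- Here `w ≤ z` ensures that an element counted on the left is also counted on the right.
        λ z-rough → rough-antitone em w z w≤z z-rough , sieveDivisors≡0 em w z a z-rough)
  where
  ∑≡primeSum : ∀ r → ∑ (elements 𝒜) (rough-C em w z r) ≡ primeSum em w z 𝒜 r
  ∑≡primeSum r = sym (primeSum-∑ em w z 𝒜 r)
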